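{- Let $\Gamma$ be a finitely generated abelian group and $X$ a finite list of elements of $\Gamma$. Let $\lambda\in X$ be a nonzero element such that $\pi(\lambda)\in\langle\pi(X\setminus\{\lambda\})\rangle_{\mathbb{R}}$. Let $X_1=X\setminus\{\lambda\}$ (removing this one occurrence of $\lambda$), viewed as a list in $\Gamma$, and let $X_2$ be the list of images of the elements of $X_1$ in the finitely generated abelian group $\Gamma/\langle\lambda\rangle$. Then $$M_X(x,y)=M_{X_1}(x,y)+M_{X_2}(x,y),$$ where $M_{X_2}$ is computed in the group $\Gamma/\langle\lambda\rangle$.
   Context: Write $\Gamma=\Lambda\times\Gamma_t$ with $\Lambda$ free abelian of finite rank and $\Gamma_t$ the (finite) torsion subgroup, and let $\pi:\Gamma\to\Lambda$ be the projection; $\langle S\rangle_{\mathbb{R}}$ denotes the real span inside $\Lambda\otimes\mathbb{R}$. For a finite list $Y$ in a finitely generated abelian group $\Gamma$ and a sublist $A\subseteq Y$: $\langle A\rangle$ is the subgroup generated by $A$; $r(A)$ is the dimension of the real span of $\pi(A)$ in $\Lambda\otimes\mathbb{R}$ (the rank of $\langle A\rangle$); $\Gamma_A=\pi^{ -1}(\Lambda\cap\langle\pi(A)\rangle_{\mathbb{R}})=(\Lambda\cap\langle\pi(A)\rangle_{\mathbb{R}})\times\Gamma_t$, which is the largest subgroup of $\Gamma$ in which $\langle A\rangle$ has finite index (hence independent of the chosen splitting); $m(A)=[\Gamma_A:\langle A\rangle]$. The multiplicity Tutte polynomial is $M_Y(x,y)=\sum_{A\subseteq Y} m(A)(x-1)^{r(Y)-r(A)}(y-1)^{|A|-r(A)}$,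 the sum running over all sublists (subsets of the index set).
   Formalization: "Nonzero element λ" is taken as π(λ) ≠ 0 (λ of infinite order); for a nonzero torsion λ the identity fails, e.g. Γ = ℤ/2, X = (1) gives M_X = y+1 but M_{X₁}+M_{X₂} = 3. -}

module Defs where

open import Algebra.Apartness.Bundles using (HeytingCommutativeRing; HeytingField)
open import Algebra.Bundles using (AbelianGroup; CommutativeRing)
open import Algebra.Bundles.Raw using (RawRing)
import Algebra.Construct.DirectProduct as DirectProduct
import Algebra.Construct.Pointwise as Pointwise
import Algebra.Definitions.RawMonoid as RawMonoidDefinitions
import Algebra.Definitions.RawSemiring as RawSemiringDefinitions
open import Algebra.Morphism.Structures using (module GroupMorphisms)
import Algebra.Properties.AbelianGroup as AbelianGroupProperties
open import Data.Bool.Base using (true; false)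
open import Data.Fin.Base using (Fin)
open import Data.Fin.Subset using (Subset; ⊤; ∣_∣; _∈_)
open import Data.Integer.Base as ℤ using (ℤ; +_; -[1+_])
open import Data.Integer.Properties using (+-0-abelianGroup)
open import Data.List.Base as List using (List; []; _∷_)
open import Data.Nat.Base using (ℕ; zero; suc; _∸_)
open import Data.Product.Base using (∃; _×_; _,_; proj₁; proj₂)
import Data.These.Base as These
import Data.Vec.Base as Vec
open import Data.Vec.Functional using (Vector)
open import Function.Base using (id)
open import Function.Bundles using (Inverse)
open import Level using (Level; _⊔_; 0ℓ) renaming (suc to lsuc)
open import Relation.Binary.Bundles using (Setoid)
import Relation.Binary.Construct.On as On
open import Relation.Binary.PropositionalEquality using (setoid)
open import Relation.Unary using (Pred)

private
  variable
    a c k k₁ k₂ ℓ p q : Level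

HasSize : Setoid c ℓ → ℕ → Set (c ⊔ ℓ)
HasSize S m = Inverse S (setoid (Fin m))

------------------------------------------------------------------------
-- Polynomials

-- R[t] as lists of coefficients, constant term first.  Trailing zeros are
-- allowed, so equality compares coefficients.
module _ (R : RawRing c ℓ) where
  private module R = RawRing R

  coefficient : List R.Carrier → ℕ → R.Carrier
  coefficient []      _       = R.0#
  coefficient (r ∷ _) zero    = r
  coefficient (_ ∷ f) (suc i) = coefficient f i

  addPolynomials : List R.Carrier → List R.Carrier → List R.Carrier
  addPolynomials = List.alignWith (These.fold id id R._+_)

  multiplyPolynomials : List R.Carrier → List R.Carrier → List R.Carrier
  multiplyPolynomials []      g = []
  multiplyPolynomials (r ∷ f) g =
    addPolynomials (List.map (r R.*_) g) (R.0# ∷ multiplyPolynomials f g)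

  polynomialRing : RawRing c ℓ
  polynomialRing = record
    { Carrier = List R.Carrier
    ; _≈_     = λ f g → ∀ i → coefficient f i R.≈ coefficient g i
    ; _+_     = addPolynomials
    ; _*_     = multiplyPolynomials
    ; -_      = List.map R.-_
    ; 0#      = []
    ; 1#      = R.1# ∷ []
    }

  constant : R.Carrier → List R.Carrier
  constant r = r ∷ []

  indeterminate : List R.Carrier
  indeterminate = R.0# ∷ R.1# ∷ []

ℤ[x] : RawRing 0ℓ 0ℓ
ℤ[x] = polynomialRing ℤ.+-*-rawRing

ℤ[x,y] : RawRing 0ℓ 0ℓ
ℤ[x,y] = polynomialRing ℤ[x]

x y : RawRing.Carrier ℤ[x,y]
x = constant ℤ[x] (indeterminate ℤ.+-*-rawRing)
y = indeterminate ℤ[x]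

sumOverSubsets : ∀ {n} → (Subset n → RawRing.Carrier ℤ[x,y]) → RawRing.Carrier ℤ[x,y]
sumOverSubsets {zero}  f = f Vec.[]
sumOverSubsets {suc n} f =
  sumOverSubsets (λ A → f (false Vec.∷ A)) + sumOverSubsets (λ A → f (true Vec.∷ A))
  where open RawRing ℤ[x,y]

------------------------------------------------------------------------
-- Subgroups and quotients

record Subgroup (Γ : AbelianGroup a ℓ) p : Set (a ⊔ ℓ ⊔ lsuc p) where
  open AbelianGroup Γ
  field
    Member    : Pred Carrier p
    resp      : ∀ {g h} → g ≈ h → Member g → Member h
    ε-closed  : Member ε
    ∙-closed  : ∀ {g h} → Member g → Member h → Member (g ∙ h)
    ⁻¹-closed : ∀ {g} → Member g → Member (g ⁻¹)

module _ (Γ : AbelianGroup a ℓ) where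
  open AbelianGroup Γ using (Carrier; _≈_; _∙_; ε; _⁻¹)

  data Generated (S : Pred Carrier p) : Pred Carrier (a ⊔ ℓ ⊔ p) where
    generator : ∀ {g} → S g → Generated S g
    respects  : ∀ {g h} → g ≈ h → Generated S g → Generated S h
    identity  : Generated S ε
    product   : ∀ {g h} → Generated S g → Generated S h → Generated S (g ∙ h)
    inverse   : ∀ {g} → Generated S g → Generated S (g ⁻¹)

  ⟨_⟩ : Pred Carrier p → Subgroup Γ (a ⊔ ℓ ⊔ p)
  ⟨ S ⟩ = record
    { Member    = Generated S
    ; resp      = respects
    ; ε-closed  = identity
    ; ∙-closed  = product
    ; ⁻¹-closed = inverse
    }

  ⟨_⟩₁ : Carrier → Subgroup Γ (a ⊔ ℓ)
  ⟨ g ⟩₁ = ⟨ (_≈ g) ⟩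

  members : ∀ {n} → Vector Carrier n → Subset n → Pred Carrier ℓ
  members Y A g = ∃ λ i → i ∈ A × g ≈ Y i

module _ (Γ : AbelianGroup a ℓ) (H : Subgroup Γ p) where
  open AbelianGroup Γ
  open AbelianGroupProperties Γ using (⁻¹-∙-comm; ⁻¹-involutive; ⁻¹-anti-homo-∙)
  open Subgroup H
  open import Relation.Binary.Reasoning.Setoid (AbelianGroup.setoid Γ)

  private
    _∼_ : Carrier → Carrier → Set p
    g ∼ h = Member (g ∙ h ⁻¹)

    ≈⇒∼ : ∀ {g h} → g ≈ h → g ∼ h
    ≈⇒∼ {g} {h} g≈h = resp (sym (trans (∙-congʳ g≈h) (inverseʳ h))) ε-closed

    ∼-sym : ∀ {g h} → g ∼ h → h ∼ g
    ∼-sym {g} {h} g∼h = resp (begin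
      (g ∙ h ⁻¹) ⁻¹      ≈⟨ ⁻¹-anti-homo-∙ g (h ⁻¹) ⟩
      (h ⁻¹) ⁻¹ ∙ g ⁻¹   ≈⟨ ∙-congʳ (⁻¹-involutive h) ⟩
      h ∙ g ⁻¹           ∎) (⁻¹-closed g∼h)

    ∼-trans : ∀ {g h j} → g ∼ h → h ∼ j → g ∼ j
    ∼-trans {g} {h} {j} g∼h h∼j = resp (begin
      (g ∙ h ⁻¹) ∙ (h ∙ j ⁻¹)   ≈⟨ assoc g (h ⁻¹) (h ∙ j ⁻¹) ⟩
      g ∙ (h ⁻¹ ∙ (h ∙ j ⁻¹))   ≈⟨ ∙-congˡ (assoc (h ⁻¹) h (j ⁻¹)) ⟨
      g ∙ ((h ⁻¹ ∙ h) ∙ j ⁻¹)   ≈⟨ ∙-congˡ (∙-congʳ (inverseˡ h)) ⟩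
      g ∙ (ε ∙ j ⁻¹)            ≈⟨ ∙-congˡ (identityˡ (j ⁻¹)) ⟩
      g ∙ j ⁻¹                  ∎) (∙-closed g∼h h∼j)

    ∼-∙-cong : ∀ {g g′ h h′} → g ∼ g′ → h ∼ h′ → (g ∙ h) ∼ (g′ ∙ h′)
    ∼-∙-cong {g} {g′} {h} {h′} g∼g′ h∼h′ = resp (begin
      (g ∙ g′ ⁻¹) ∙ (h ∙ h′ ⁻¹)   ≈⟨ assoc g (g′ ⁻¹) (h ∙ h′ ⁻¹) ⟩
      g ∙ (g′ ⁻¹ ∙ (h ∙ h′ ⁻¹))   ≈⟨ ∙-congˡ (assoc (g′ ⁻¹) h (h′ ⁻¹)) ⟨
      g ∙ ((g′ ⁻¹ ∙ h) ∙ h′ ⁻¹)   ≈⟨ ∙-congˡ (∙-congʳ (comm (g′ ⁻¹) h)) ⟩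
      g ∙ ((h ∙ g′ ⁻¹) ∙ h′ ⁻¹)   ≈⟨ ∙-congˡ (assoc h (g′ ⁻¹) (h′ ⁻¹)) ⟩
      g ∙ (h ∙ (g′ ⁻¹ ∙ h′ ⁻¹))   ≈⟨ assoc g h (g′ ⁻¹ ∙ h′ ⁻¹) ⟨
      (g ∙ h) ∙ (g′ ⁻¹ ∙ h′ ⁻¹)   ≈⟨ ∙-congˡ (⁻¹-∙-comm g′ h′) ⟩
      (g ∙ h) ∙ (g′ ∙ h′) ⁻¹      ∎) (∙-closed g∼g′ h∼h′)

    ∼-⁻¹-cong : ∀ {g h} → g ∼ h → (g ⁻¹) ∼ (h ⁻¹)
    ∼-⁻¹-cong {g} {h} g∼h = resp (sym (⁻¹-∙-comm g (h ⁻¹))) (⁻¹-closed g∼h)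

  infixl 7 _/_

  _/_ : AbelianGroup a p
  _/_ = record
    { Carrier = Carrier
    ; _≈_     = _∼_
    ; _∙_     = _∙_
    ; ε       = ε
    ; _⁻¹     = _⁻¹
    ; isAbelianGroup = record
      { isGroup = record
        { isMonoid = record
          { isSemigroup = record
            { isMagma = record
              { isEquivalence = record
                { refl = ≈⇒∼ refl ; sym = ∼-sym ; trans = ∼-trans }
              ; ∙-cong = ∼-∙-cong
              }
            ; assoc = λ g h j → ≈⇒∼ (assoc g h j)
            }
          ; identity = (λ g → ≈⇒∼ (identityˡ g)) , (λ g → ≈⇒∼ (identityʳ g))
          }
        ; inverse = (λ g → ≈⇒∼ (inverseˡ g)) , (λ g → ≈⇒∼ (inverseʳ g))
        ; ⁻¹-cong = ∼-⁻¹-cong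
        }
      ; comm = λ g h → ≈⇒∼ (comm g h)
      }
    }

  quotientMap : Carrier → AbelianGroup.Carrier _/_
  quotientMap = id

  -- [ G : H ] = m, for a subgroup G containing H.
  HasIndex : Pred Carrier q → ℕ → Set (a ⊔ p ⊔ q)
  HasIndex G = HasSize (On.setoid (AbelianGroup.setoid _/_) (proj₁ {B = G}))

------------------------------------------------------------------------
-- Splittings Γ ≅ Λ × Γₜ

ℤ^_ : ℕ → AbelianGroup 0ℓ 0ℓ
ℤ^ d = Pointwise.abelianGroup (Fin d) +-0-abelianGroup

-- Classically every finitely generated abelian group has a splitting.
-- Constructively the structure theorem can fail for lack of decidability, so
-- the splitting is what a "finitely generated abelian group" comes with.
-- Λ is identified with ℤ^ rank by choosing a basis.
record Splitting (Γ : AbelianGroup a ℓ) : Set (lsuc (a ⊔ ℓ)) where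
  field
    rank          : ℕ
    torsion       : AbelianGroup a ℓ
    torsionSize   : ℕ
    torsionFinite : HasSize (AbelianGroup.setoid torsion) torsionSize

  Λ×Γₜ : AbelianGroup a ℓ
  Λ×Γₜ = DirectProduct.abelianGroup (ℤ^ rank) torsion

  open GroupMorphisms (AbelianGroup.rawGroup Γ) (AbelianGroup.rawGroup Λ×Γₜ)
    using (IsGroupIsomorphism)

  field
    split              : AbelianGroup.Carrier Γ → AbelianGroup.Carrier Λ×Γₜ
    isGroupIsomorphism : IsGroupIsomorphism split

  π : AbelianGroup.Carrier Γ → Vector ℤ rank
  π g = proj₁ (split g)

------------------------------------------------------------------------
-- Linear algebra in Λ ⊗ K

-- K stands for ℝ, which the standard library lacks.  It ranges over all
-- Heyting fields of characteristic zero, of which the reals are one.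
module _ (K : HeytingField k k₁ k₂) where
  open HeytingField K using (Carrier; _≈_; _#_; _+_; _*_; -_; 0#; 1#; heytingCommutativeRing)
  open HeytingCommutativeRing heytingCommutativeRing using (commutativeRing)
  open CommutativeRing commutativeRing using (+-rawMonoid)
  open RawMonoidDefinitions +-rawMonoid using (sum) renaming (_×_ to _·_)

  CharacteristicZero : Set k₂
  CharacteristicZero = ∀ n → (suc n · 1#) # 0#

  fromℤ : ℤ → Carrier
  fromℤ (+ n)    = n · 1#
  fromℤ -[1+ n ] = - (suc n · 1#)

  infix 4 _≋_

  _≋_ : ∀ {d} → Vector Carrier d → Vector Carrier d → Set k₁
  u ≋ v = ∀ j → u j ≈ v j

  data Span {d} (S : Pred (Vector Carrier d) p) : Pred (Vector Carrier d) (k ⊔ k₁ ⊔ p) where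
    generator : ∀ {u} → S u → Span S u
    respects  : ∀ {u v} → u ≋ v → Span S u → Span S v
    zero      : Span S (λ _ → 0#)
    plus      : ∀ {u v} → Span S u → Span S v → Span S (λ j → u j + v j)
    scale     : ∀ r {u} → Span S u → Span S (λ j → r * u j)

  LinearlyIndependent : ∀ {r d} → Vector (Vector Carrier d) r → Set (k ⊔ k₁)
  LinearlyIndependent {r} b =
    (s : Vector Carrier r) → (∀ j → sum (λ i → s i * b i j) ≈ 0#) → ∀ i → s i ≈ 0#

  record HasDimension {d} (V : Pred (Vector Carrier d) p) (r : ℕ) : Set (k ⊔ k₁ ⊔ p) where
    field
      basis       : Vector (Vector Carrier d) r
      inside      : ∀ i → V (basis i)
      independent : LinearlyIndependent basis
      spanning    : ∀ {v} → V v → Span (λ u → ∃ λ i → u ≋ basis i) v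

  module _ {Γ : AbelianGroup a ℓ} (σ : Splitting Γ) where
    private module Γ = AbelianGroup Γ
    open Splitting σ using (rank; π)

    -- The image of π g in Λ ⊗ K, that is, in K ^ rank.
    π⊗1 : Γ.Carrier → Vector Carrier rank
    π⊗1 g j = fromℤ (π g j)

    ⟨π_⟩ : Pred Γ.Carrier p → Pred (Vector Carrier rank) (k ⊔ k₁ ⊔ a ⊔ p)
    ⟨π S ⟩ = Span (λ u → ∃ λ g → S g × u ≋ π⊗1 g)

    -- Γ_A = π⁻¹ (Λ ∩ ⟨ π A ⟩)
    saturation : Pred Γ.Carrier p → Pred Γ.Carrier (k ⊔ k₁ ⊔ a ⊔ p)
    saturation S g = ⟨π S ⟩ (π⊗1 g)

    ----------------------------------------------------------------------
    -- The multiplicity Tutte polynomial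

    -- Dimensions and indices cannot be computed uniformly from these
    -- definitions, so the functions r and m are given by their defining
    -- properties, which determine them uniquely.
    record RankAndMultiplicity {n} (Y : Vector Γ.Carrier n)
      : Set (k ⊔ k₁ ⊔ a ⊔ ℓ) where
      field
        r           : Subset n → ℕ
        r-dimension : ∀ A → HasDimension ⟨π members Γ Y A ⟩ (r A)
        m           : Subset n → ℕ
        m-index     : ∀ A → HasIndex Γ (⟨ Γ ⟩ (members Γ Y A)) (saturation (members Γ Y A)) (m A)

multiplicityTutte : {K : HeytingField k k₁ k₂} {Γ : AbelianGroup a ℓ} {σ : Splitting Γ}
                    {n : ℕ} {Y : Vector (AbelianGroup.Carrier Γ) n} →
                    RankAndMultiplicity K σ Y → RawRing.Carrier ℤ[x,y]
multiplicityTutte D =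
  sumOverSubsets (λ A →
    m A · ((x + - 1#) ^ (r ⊤ ∸ r A) * (y + - 1#) ^ (∣ A ∣ ∸ r A)))
  where
  open RawRing ℤ[x,y]
  open RawSemiringDefinitions rawSemiring using (_^_) renaming (_×_ to _·_)
  open RankAndMultiplicity D

{-# OPTIONS --safe #-}

-- Split the sum over the subsets of X according to whether they contain the occurrence of λ.
-- Subsets avoiding λ give the terms of X₁, because λ lies in the span of X₁ and so the total
-- rank is unchanged.  For subsets containing λ, the map Γ → Γ/⟨λ⟩ → ℤ^rank σ₂ kills torsion and
-- hence factors through a K-linear map P; choosing lifts of the standard basis of ℤ^rank σ₂
-- gives a linear map Q with v − QPv ∈ K·π(λ) for all v, because every g − QPg is torsion
-- modulo λ.  So P is surjective with kernel K·π(λ): it lowers each rank by one, and it matches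
-- the saturations and the generated subgroups, hence also the multiplicities.

module Submission where

open import Defs
open import Algebra.Apartness.Bundles using (HeytingCommutativeRing; HeytingField)
import Algebra.Apartness.Properties.HeytingCommutativeRing as HeytingCommutativeRingProperties
open import Algebra.Bundles using (AbelianGroup; CommutativeRing; Monoid)
open import Algebra.Bundles.Raw using (RawRing)
import Algebra.Definitions.RawMonoid as RawMonoidDefinitions
import Algebra.Definitions.RawSemiring as RawSemiringDefinitions
open import Algebra.Morphism.Structures using (module GroupMorphisms; module MonoidMorphisms)
import Algebra.Properties.AbelianGroup as AbelianGroupProperties
import Algebra.Properties.CommutativeSemigroup as CommutativeSemigroupProperties
import Algebra.Properties.Monoid.Mult as MonoidMult
import Algebra.Properties.Monoid.Sum as MonoidSum
import Algebra.Properties.Ring as RingProperties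
import Algebra.Properties.Semiring.Mult as SemiringMult
import Algebra.Properties.Semiring.Sum as SemiringSum
open import Data.Bool.Base using (true; false)
open import Data.Fin.Base using (Fin; zero; suc; punchIn; punchOut; toℕ)
import Data.Fin.Permutation as Permutation
open import Data.Fin.Properties using (_≟_; pigeonhole; punchIn-punchOut)
open import Data.Fin.Subset using (Subset; ⊤; ∣_∣)
open import Data.Integer.Base as ℤ using (ℤ; +_; -[1+_]; _⊖_)
import Data.Integer.Properties as ℤ
open import Data.List.Base as List using (List; []; _∷_)
open import Data.List.Properties using (map-id)
open import Data.Nat.Base as ℕ using (ℕ; zero; suc; _∸_; _≤_; z≤n; s≤s)
import Data.Nat.Properties as ℕ
open import Data.Product.Base using (∃; _×_; _,_; proj₁; proj₂)
open import Data.Sum.Base using (_⊎_; inj₁; inj₂)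
import Data.Vec.Base as Vec
open import Data.Vec.Functional as Vector using (Vector; insertAt; removeAt; map; tail)
open import Data.Vec.Functional.Properties using (insertAt-lookup; insertAt-punchIn)
import Data.Vec.Properties as Vec
open import Function.Base using (_∘_; _$_; id)
open import Function.Bundles using (Inverse)
import Function.Construct.Composition as Composition
import Function.Construct.Symmetry as Symmetry
open import Level using (Level)
open import Relation.Binary.Bundles using (Setoid)
open import Relation.Binary.PropositionalEquality as ≡ using (_≡_)
import Relation.Binary.Reasoning.Setoid as SetoidReasoning
open import Relation.Nullary using (yes; no)
open import Relation.Nullary.Decidable using (decidable-stable)
open import Relation.Nullary.Negation using (¬_; contradiction)
open import Relation.Unary using (Pred; _⊆_)

-- The numbers `r` and `m` are known only through `HasDimension` and `HasIndex`, so every comparison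
-- rests on uniqueness: corresponding spans force equal dimensions, matching finite quotients force
-- equal indices. Since equality in `K` is undecidable, no pivot can be searched for; uniqueness of
-- dimension is rescued by the decidability of `≤` on ℕ, which permits arguing by contradiction. The
-- splitting `σ₂` of the quotient is arbitrary and its coordinates bear no given relation to those
-- of `σ`; the maps P and Q supply that relation. That π(λ) is nonzero is what makes the rank drop
-- under contraction. For a torsion λ the rank would stay, and each subset containing λ would
-- contribute its contracted term times an extra factor y - 1. With the drop, the size of the subset
-- and both ranks decrease by one together, so all exponents are preserved.

private
  variable
    a b k k₁ k₂ ℓ ℓ′ p q : Level

-- Standard basis vectors with entries in any type

indicator : {A : Set a} → A → A → ∀ {n} → Fin n → Vector A n
indicator z o zero    zero    = o
indicator z o zero    (suc j) = z
indicator z o (suc i) zero    = z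
indicator z o (suc i) (suc j) = indicator z o i j

indicator-sym : {A : Set a} (z o : A) → ∀ {n} (i j : Fin n) →
                indicator z o i j ≡ indicator z o j i
indicator-sym z o zero    zero    = ≡.refl
indicator-sym z o zero    (suc j) = ≡.refl
indicator-sym z o (suc i) zero    = ≡.refl
indicator-sym z o (suc i) (suc j) = indicator-sym z o i j

-- For `f = fromℤ K` this matches the standard basis of the lattice with that of its extension to
-- `K`.
map-indicator : {A : Set a} {B : Set b} (f : A → B) (z o : A) → ∀ {n} (i j : Fin n) →
                f (indicator z o i j) ≡ indicator (f z) (f o) i j
map-indicator f z o zero    zero    = ≡.refl
map-indicator f z o zero    (suc j) = ≡.refl
map-indicator f z o (suc i) zero    = ≡.refl
map-indicator f z o (suc i) (suc j) = map-indicator f z o i j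

-- Linear algebra and dimension over a Heyting field

module LinearAlgebra (K : HeytingField k k₁ k₂) where

  open HeytingField K
    using (Carrier; _≈_; _#_; _+_; _*_; -_; _-_; 0#; 1#; heytingCommutativeRing;
           #⇒invertible; tight)
  open HeytingCommutativeRing heytingCommutativeRing using (commutativeRing)
  open CommutativeRing commutativeRing hiding (Carrier; _≈_; _+_; _*_; -_; _-_; 0#; 1#; zero)
  open RingProperties ring using (-‿distribˡ-*)
  open SemiringSum semiring
  open HeytingCommutativeRingProperties heytingCommutativeRing using (x-0≈x)
  open SetoidReasoning setoid

  infix 4 _≃_
  _≃_ : ∀ {d} → Vector Carrier d → Vector Carrier d → Set k₁
  _≃_ = _≋_ K

  ¬#⇒≈ : ∀ {u v} → ¬ (u # v) → u ≈ v
  ¬#⇒≈ = proj₁ (tight _ _)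

  ≈⇒¬# : ∀ {u v} → u ≈ v → ¬ (u # v)
  ≈⇒¬# = proj₂ (tight _ _)

  #0⇒inverse : ∀ {u} → u # 0# → ∃ λ u⁻¹ → u⁻¹ * u ≈ 1#
  #0⇒inverse u#0 with #⇒invertible u#0
  ... | u⁻¹ , u⁻¹u≈1 , _ = u⁻¹ , trans (*-congˡ (sym (x-0≈x _))) u⁻¹u≈1

  cancel-#0 : ∀ {u v w} (u#0 : u # 0#) → u * v ≈ w → v ≈ proj₁ (#0⇒inverse u#0) * w
  cancel-#0 {u} {v} {w} u#0 uv≈w = let u⁻¹ , u⁻¹u≈1 = #0⇒inverse u#0 in begin
    v              ≈⟨ *-identityˡ v ⟨
    1# * v         ≈⟨ *-congʳ u⁻¹u≈1 ⟨
    (u⁻¹ * u) * v  ≈⟨ *-assoc _ _ _ ⟩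
    u⁻¹ * (u * v)  ≈⟨ *-congˡ uv≈w ⟩
    u⁻¹ * w        ∎

  #0-cancels-0 : ∀ {u v} → u # 0# → u * v ≈ 0# → v ≈ 0#
  #0-cancels-0 u#0 uv≈0 = trans (cancel-#0 u#0 uv≈0) (zeroʳ _)

  sum-zero : ∀ {n} {f : Vector Carrier n} → (∀ i → f i ≈ 0#) → sum f ≈ 0#
  sum-zero {n} f≈0 = trans (sum-cong-≋ f≈0) (sum-replicate-zero n)

  unit : ∀ {n} → Fin n → Vector Carrier n
  unit = indicator 0# 1#

  sum-unit : ∀ {n} (i : Fin n) (f : Vector Carrier n) → sum (λ j → unit i j * f j) ≈ f i
  sum-unit {suc n} zero f =
    trans (+-cong (*-identityˡ _) (sum-zero {n} λ j → zeroˡ (f (suc j)))) (+-identityʳ _)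
  sum-unit (suc i) f =
    trans (+-cong (zeroˡ _) (sum-unit i (tail f))) (+-identityˡ _)

  sum-unitʳ : ∀ {n} (i : Fin n) (f : Vector Carrier n) → sum (λ j → f j * unit j i) ≈ f i
  sum-unitʳ i f = trans
    (sum-cong-≋ λ j → trans (*-comm _ _) (*-congʳ (reflexive (indicator-sym 0# 1# j i))))
    (sum-unit i f)

  combination : ∀ {r d} → Vector (Vector Carrier d) r → Vector Carrier r → Vector Carrier d
  combination b s j = sum (λ i → s i * b i j)

  module _ {r d} (b : Vector (Vector Carrier d) r) where

    combination-cong : ∀ {s t} → s ≃ t → combination b s ≃ combination b t
    combination-cong s≃t j = sum-cong-≋ λ i → *-congʳ (s≃t i)

    combination-congˡ : ∀ {b′} → (∀ i → b i ≃ b′ i) → ∀ s → combination b s ≃ combination b′ s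
    combination-congˡ b≃b′ s j = sum-cong-≋ λ i → *-congˡ (b≃b′ i j)

    combination-+ : ∀ s t → combination b (λ i → s i + t i) ≃
                            λ j → combination b s j + combination b t j
    combination-+ s t j = trans (sum-cong-≋ λ i → distribʳ (b i j) (s i) (t i))
                                (∑-distrib-+ (λ i → s i * b i j) (λ i → t i * b i j))

    combination-* : ∀ c s → combination b (λ i → c * s i) ≃ λ j → c * combination b s j
    combination-* c s j = trans (sum-cong-≋ λ i → *-assoc c (s i) (b i j))
                                (sym (*-distribˡ-sum c (λ i → s i * b i j)))

    combination-0 : combination b (λ _ → 0#) ≃ λ _ → 0#
    combination-0 j = sum-zero λ i → zeroˡ (b i j)

    combination-unit : ∀ i → combination b (unit i) ≃ b i
    combination-unit i j = sum-unit i λ i → b i j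

    combination-combination : ∀ {e} (M : Vector (Vector Carrier r) e) s →
      combination b (combination M s) ≃ combination (combination b ∘ M) s
    combination-combination M s j = begin
      sum (λ i → sum (λ k → s k * M k i) * b i j)
        ≈⟨ sum-cong-≋ (λ i → *-distribʳ-sum (b i j) (λ k → s k * M k i)) ⟩
      sum (λ i → sum (λ k → (s k * M k i) * b i j))
        ≈⟨ ∑-comm (λ i k → (s k * M k i) * b i j) ⟩
      sum (λ k → sum (λ i → (s k * M k i) * b i j))
        ≈⟨ sum-cong-≋ (λ k → sum-cong-≋ λ i → *-assoc (s k) (M k i) (b i j)) ⟩
      sum (λ k → sum (λ i → s k * (M k i * b i j)))
        ≈⟨ sum-cong-≋ (λ k → *-distribˡ-sum (s k) (λ i → M k i * b i j)) ⟨
      sum (λ k → s k * sum (λ i → M k i * b i j))  ∎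

    span⇒combination : ∀ {v} → Span K (λ u → ∃ λ i → u ≃ b i) v →
                       ∃ λ s → combination b s ≃ v
    span⇒combination (generator (i , u≃bᵢ)) =
      unit i , λ j → trans (combination-unit i j) (sym (u≃bᵢ j))
    span⇒combination (respects u≃v u∈) = let s , bs≃u = span⇒combination u∈ in
      s , λ j → trans (bs≃u j) (u≃v j)
    span⇒combination zero = _ , combination-0
    span⇒combination (plus u∈ v∈) =
      let s , bs≃u = span⇒combination u∈
          t , bt≃v = span⇒combination v∈
      in _ , λ j → trans (combination-+ s t j) (+-cong (bs≃u j) (bt≃v j))
    span⇒combination (scale c u∈) = let s , bs≃u = span⇒combination u∈ in
      _ , λ j → trans (combination-* c s j) (*-congˡ (bs≃u j))

  combination-insertAt : ∀ {r d} (b : Vector (Vector Carrier d) (suc r)) i c t j →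
    combination b (insertAt t i c) j ≈ c * b i j + combination (removeAt b i) t j
  combination-insertAt b i c t j = trans
    (sum-remove {i = i} (λ k → insertAt t i c k * b k j))
    (+-cong (*-congʳ (reflexive (insertAt-lookup t i c)))
            (sum-cong-≋ λ k → *-congʳ (reflexive (insertAt-punchIn t i c k))))

  Independent : ∀ {r d} → Vector (Vector Carrier d) r → Set _
  Independent = LinearlyIndependent K

  module _ {r n} (M : Vector (Vector Carrier (suc n)) (suc r)) (i : Fin (suc r))
           (pivot : M i zero # 0#) where

    private
      pivot⁻¹ = proj₁ (#0⇒inverse pivot)

      factor : Vector Carrier r
      factor j = - (M (punchIn i j) zero * pivot⁻¹)

      reduced : Vector (Vector Carrier (suc n)) r
      reduced j k = M (punchIn i j) k + factor j * M i k

      reduced-zero : ∀ j → reduced j zero ≈ 0#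
      reduced-zero j = let m = M (punchIn i j) zero in begin
        m + - (m * pivot⁻¹) * M i zero    ≈⟨ +-congˡ (-‿distribˡ-* _ _) ⟨
        m + - ((m * pivot⁻¹) * M i zero)  ≈⟨ +-congˡ (-‿cong (*-assoc _ _ _)) ⟩
        m + - (m * (pivot⁻¹ * M i zero))
          ≈⟨ +-congˡ (-‿cong (*-congˡ (proj₂ (#0⇒inverse pivot)))) ⟩
        m + - (m * 1#)                    ≈⟨ +-congˡ (-‿cong (*-identityʳ m)) ⟩
        m - m                             ≈⟨ -‿inverseʳ m ⟩
        0#                                ∎

      -- The coefficient inserted at the pivot row collects all the multiples of that row which the
      -- reduction added, so a relation among the reduced rows is a relation among the rows of `M`.
      combination-reduced : ∀ t k →
        combination M (insertAt t i (sum λ j → t j * factor j)) k ≈ combination reduced t k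
      combination-reduced t k = begin
        combination M (insertAt t i (sum λ j → t j * factor j)) k
          ≈⟨ combination-insertAt M i _ t k ⟩
        sum (λ j → t j * factor j) * M i k + combination (removeAt M i) t k
          ≈⟨ +-congʳ (*-distribʳ-sum (M i k) (λ j → t j * factor j)) ⟩
        sum (λ j → (t j * factor j) * M i k) + combination (removeAt M i) t k
          ≈⟨ +-comm _ _ ⟩
        combination (removeAt M i) t k + sum (λ j → (t j * factor j) * M i k)
          ≈⟨ ∑-distrib-+ (λ j → t j * M (punchIn i j) k) (λ j → (t j * factor j) * M i k) ⟨
        sum (λ j → t j * M (punchIn i j) k + (t j * factor j) * M i k)
          ≈⟨ sum-cong-≋ (λ j → trans (+-congˡ (*-assoc (t j) (factor j) (M i k)))
                                  (sym (distribˡ (t j) _ _))) ⟩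
        combination reduced t k  ∎

    -- One step of Gaussian elimination. The first column of `reduced` vanishes, so dropping it
    -- loses nothing, and relations among the shortened rows still lift to `M`.
    eliminate : Vector (Vector Carrier n) r
    eliminate = tail ∘ reduced

    eliminate-independent : Independent M → Independent eliminate
    eliminate-independent ind t et≃0 j = trans
      (sym (reflexive (insertAt-punchIn t i _ j)))
      (ind (insertAt t i _) (λ k → trans (combination-reduced t k) (reduced≃0 k)) (punchIn i j))
      where
      reduced≃0 : combination reduced t ≃ λ _ → 0#
      reduced≃0 zero    = sum-zero λ j → trans (*-congˡ (reduced-zero j)) (zeroʳ _)
      reduced≃0 (suc k) = et≃0 k

  module _ (1#0 : 1# # 0#) where

    independent⇒≤ : ∀ {r n} (M : Vector (Vector Carrier n) r) → Independent M → r ≤ n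
    independent⇒≤ {zero}          M ind = z≤n
    -- In dimension zero every combination vanishes, also the one with a coefficient `1#`;
    -- independence would then give `1# ≈ 0#`.
    independent⇒≤ {suc r} {zero}  M ind =
      contradiction 1#0 (≈⇒¬# (ind (unit zero) (λ ()) zero))
    -- The inequality is decidable, so it may be assumed to fail; then no entry of the
    -- first column can serve as a pivot, so by tightness the column vanishes.
    independent⇒≤ {suc r} {suc n} M ind = decidable-stable (suc r ℕ.≤? suc n) λ r≰n →
      r≰n $ ℕ.m≤n⇒m≤1+n $ independent⇒≤ (tail ∘ M) λ s Ms≃0 → ind s λ
        { zero    → sum-zero {f = λ i → s i * M i zero} λ i → trans
            (*-congˡ (¬#⇒≈ λ pivot → r≰n
              (s≤s (independent⇒≤ (eliminate M i pivot) (eliminate-independent M i pivot ind)))))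
            (zeroʳ _)
        ; (suc k) → Ms≃0 k
        }

    -- Steinitz: `b′` carries a relation among the coordinate vectors `proj₁ ∘ b∈` to a relation
    -- among the `b i`. So the coordinate vectors are independent, and there are `r` of them in
    -- dimension `r′`.
    exchange : ∀ {r r′ d} {b : Vector (Vector Carrier d) r} {b′ : Vector (Vector Carrier d) r′} →
               Independent b → (∀ i → ∃ λ s → combination b′ s ≃ b i) → r ≤ r′
    exchange {b = b} {b′} ind b∈ = independent⇒≤ (proj₁ ∘ b∈) λ t Mt≃0 → ind t λ j → begin
      combination b t j
        ≈⟨ combination-congˡ _ (λ i → proj₂ (b∈ i)) t j ⟨
      combination (combination b′ ∘ proj₁ ∘ b∈) t j
        ≈⟨ combination-combination b′ (proj₁ ∘ b∈) t j ⟨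
      combination b′ (combination (proj₁ ∘ b∈) t) j
        ≈⟨ combination-cong b′ Mt≃0 j ⟩
      combination b′ (λ _ → 0#) j
        ≈⟨ combination-0 b′ j ⟩
      0#  ∎

    dimension-mono : ∀ {d r r′} {V : Pred (Vector Carrier d) p} {V′ : Pred (Vector Carrier d) q} →
                     V ⊆ V′ → HasDimension K V r → HasDimension K V′ r′ → r ≤ r′
    dimension-mono V⊆V′ dim dim′ = exchange (independent dim) λ i →
      span⇒combination (basis dim′) (spanning dim′ (V⊆V′ (inside dim i)))
      where open HasDimension

    dimension-unique : ∀ {d r r′} {V : Pred (Vector Carrier d) p} {V′ : Pred (Vector Carrier d) q} →
                       V ⊆ V′ → V′ ⊆ V → HasDimension K V r → HasDimension K V′ r′ → r ≡ r′
    dimension-unique V⊆V′ V′⊆V dim dim′ =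
      ℕ.≤-antisym (dimension-mono V⊆V′ dim dim′) (dimension-mono V′⊆V dim′ dim)

-- Homomorphisms, torsion elements and lifts of a lattice basis

module _ (M : Monoid a ℓ) (N : Monoid b ℓ′) where
  private
    module M = Monoid M
    module N = Monoid N
  open MonoidMorphisms M.rawMonoid N.rawMonoid using (IsMonoidHomomorphism)
  open RawMonoidDefinitions M.rawMonoid using () renaming (_×_ to _·ᴹ_; sum to sumᴹ)
  open RawMonoidDefinitions N.rawMonoid using () renaming (_×_ to _·ᴺ_; sum to sumᴺ)

  module _ {f : M.Carrier → N.Carrier} (f-hom : IsMonoidHomomorphism f) where
    open IsMonoidHomomorphism f-hom

    homo-multiple : ∀ n g → f (n ·ᴹ g) N.≈ n ·ᴺ f g
    homo-multiple zero    g = ε-homo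
    homo-multiple (suc n) g = N.trans (homo _ _) (N.∙-congˡ (homo-multiple n g))

    homo-sum : ∀ {n} (g : Vector M.Carrier n) → f (sumᴹ g) N.≈ sumᴺ (f ∘ g)
    homo-sum {zero}  g = ε-homo
    homo-sum {suc n} g = N.trans (homo _ _) (N.∙-congˡ (homo-sum (tail g)))

module _ (M : Monoid a ℓ) where
  open Monoid M
  open RawMonoidDefinitions rawMonoid using () renaming (_×_ to _·_)

  multiple-ε : ∀ n → n · ε ≈ ε
  multiple-ε zero    = refl
  multiple-ε (suc n) = trans (identityˡ _) (multiple-ε n)

module _ (Γ : AbelianGroup a ℓ) where
  open AbelianGroup Γ
  open AbelianGroupProperties Γ using (identityʳ-unique)
  open RawMonoidDefinitions rawMonoid using (sum) renaming (_×_ to _·_)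
  open MonoidMult monoid using (×-homo-+)

  -- Two of the `suc m` multiples `0 · g`, ..., `m · g` coincide, and their difference annihilates
  -- `g`. Reading `i < j` as `suc i + k ≡ j` makes the annihilating multiple visibly positive.
  finite⇒torsion : ∀ {m} → HasSize setoid m → ∀ g → ∃ λ n → suc n · g ≈ ε
  finite⇒torsion {m} size g
    with i , j , i<j , fᵢ≡fⱼ ← pigeonhole (ℕ.n<1+n m) (λ i → Inverse.to size (toℕ i · g))
    with k , 1+i+k≡j ← ℕ.m≤n⇒∃[o]m+o≡n i<j
    = k , identityʳ-unique (toℕ i · g) (suc k · g) (begin
      toℕ i · g ∙ suc k · g    ≈⟨ ×-homo-+ g (toℕ i) (suc k) ⟨
      (toℕ i ℕ.+ suc k) · g    ≡⟨ ≡.cong (_· g) (≡.trans (ℕ.+-suc (toℕ i) k) 1+i+k≡j) ⟩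
      toℕ j · g                ≈⟨ Inverse.strictlyInverseʳ size (toℕ j · g) ⟨
      Inverse.from size (Inverse.to size (toℕ j · g))
                               ≡⟨ ≡.cong (Inverse.from size) fᵢ≡fⱼ ⟨
      Inverse.from size (Inverse.to size (toℕ i · g))
                               ≈⟨ Inverse.strictlyInverseʳ size (toℕ i · g) ⟩
      toℕ i · g                ∎)
    where open SetoidReasoning setoid

  integerMultiple : ℤ → Carrier → Carrier
  integerMultiple (+ n)    g = n · g
  integerMultiple -[1+ n ] g = (suc n · g) ⁻¹

  integerCombination : ∀ {d} → Vector Carrier d → Vector ℤ d → Carrier
  integerCombination e z = sum (λ k → integerMultiple (z k) (e k))

module _ {Γ : AbelianGroup a ℓ} (σ : Splitting Γ) where
  open AbelianGroup Γ
  open RawMonoidDefinitions rawMonoid using () renaming (_×_ to _·_)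
  open Splitting σ
  open GroupMorphisms.IsGroupIsomorphism isGroupIsomorphism
  private module T = AbelianGroup torsion

  π-cong : ∀ {g h} → g ≈ h → ∀ j → π g j ≡ π h j
  π-cong g≈h = proj₁ (⟦⟧-cong g≈h)

  -- Only the torsion component of `split g` can be nonzero. A positive multiple that kills this
  -- component kills `split g`, hence `g` by injectivity.
  kernel⇒torsion : ∀ g → (∀ j → π g j ≡ + 0) → ∃ λ n → suc n · g ≈ ε
  kernel⇒torsion g πg≡0 with n , nt≈ε ← finite⇒torsion torsion torsionFinite (proj₂ (split g)) =
    n , injective (AbelianGroup.trans Λ×Γₜ
      ( (λ j → ≡.trans (homo-multiple monoid ℤ.+-0-monoid (π-hom j) (suc n) g)
              (≡.trans (MonoidMult.×-congʳ ℤ.+-0-monoid (suc n) (πg≡0 j))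
                       (multiple-ε ℤ.+-0-monoid (suc n))))
      , T.trans (homo-multiple monoid T.monoid τ-hom (suc n) g) nt≈ε
      )
      (AbelianGroup.sym Λ×Γₜ ε-homo))
    where
    π-hom : ∀ j → MonoidMorphisms.IsMonoidHomomorphism rawMonoid ℤ.+-0-rawMonoid (λ h → π h j)
    π-hom j = record
      { isMagmaHomomorphism = record
        { isRelHomomorphism = record { cong = λ g≈h → π-cong g≈h j }
        ; homo = λ g h → proj₁ (∙-homo g h) j
        }
      ; ε-homo = proj₁ ε-homo j
      }
    τ-hom : MonoidMorphisms.IsMonoidHomomorphism rawMonoid T.rawMonoid (λ h → proj₂ (split h))
    τ-hom = record
      { isMagmaHomomorphism = record
        { isRelHomomorphism = record { cong = λ g≈h → proj₂ (⟦⟧-cong g≈h) }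
        ; homo = λ g h → proj₂ (∙-homo g h)
        }
      ; ε-homo = proj₂ ε-homo
      }

  basisLift : Vector Carrier rank
  basisLift k = proj₁ (surjective (indicator (+ 0) (+ 1) k , T.ε))

  π-basisLift : ∀ k j → π (basisLift k) j ≡ indicator (+ 0) (+ 1) k j
  π-basisLift k = proj₁ (proj₂ (surjective (indicator (+ 0) (+ 1) k , T.ε)) refl)

  -- Assembled from lifts, not taken as the preimage of `(π g , T.ε)`, so that an additive map
  -- evaluates on it as a combination of its values on `basisLift`.
  projection : Carrier → Carrier
  projection g = integerCombination Γ basisLift (π g)

-- Additive maps from a group to the field

module OverField (K : HeytingField k k₁ k₂) where
  private module K = HeytingField K
  open K using (_+_; _*_; -_; 0#; 1#; _#_; heytingCommutativeRing)
  open HeytingCommutativeRing heytingCommutativeRing using (commutativeRing)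
  open CommutativeRing commutativeRing
    using (ring; semiring; setoid; +-abelianGroup; +-monoid; +-rawMonoid)
  open RawMonoidDefinitions +-rawMonoid using () renaming (_×_ to _·_)
  open RingProperties ring
    using (-‿+-comm; -‿distribˡ-*; -‿involutive; -0#≈0#; xyx⁻¹≈y; +-cancelʳ)
  open SemiringSum semiring using (sum; sum-cong-≋)
  open SemiringMult semiring using (×-homo-+; ×-assoc-*; ×-congʳ)
  open LinearAlgebra K
  open SetoidReasoning setoid

  fromℤ-⊖ : ∀ m n → fromℤ K (m ⊖ n) K.≈ m · 1# + - (n · 1#)
  fromℤ-⊖ zero    zero    = K.sym (K.-‿inverseʳ 0#)
  fromℤ-⊖ zero    (suc n) = K.sym (K.+-identityˡ _)
  fromℤ-⊖ (suc m) zero    = K.sym (K.trans (K.+-congˡ -0#≈0#) (K.+-identityʳ _))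
  fromℤ-⊖ (suc m) (suc n) = begin
    fromℤ K (suc m ⊖ suc n)                ≡⟨ ≡.cong (fromℤ K) (ℤ.[1+m]⊖[1+n]≡m⊖n m n) ⟩
    fromℤ K (m ⊖ n)                        ≈⟨ fromℤ-⊖ m n ⟩
    m · 1# + - (n · 1#)                    ≈⟨ K.+-congʳ (xyx⁻¹≈y 1# (m · 1#)) ⟨
    (1# + m · 1# + - 1#) + - (n · 1#)      ≈⟨ K.+-assoc _ _ _ ⟩
    (1# + m · 1#) + (- 1# + - (n · 1#))    ≈⟨ K.+-congˡ (-‿+-comm 1# (n · 1#)) ⟩
    (1# + m · 1#) + - (1# + n · 1#)        ∎

  fromℤ-+ : ∀ y z → fromℤ K (y ℤ.+ z) K.≈ fromℤ K y + fromℤ K z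
  fromℤ-+ (+ m)    (+ n)    = ×-homo-+ 1# m n
  fromℤ-+ (+ m)    -[1+ n ] = fromℤ-⊖ m (suc n)
  fromℤ-+ -[1+ m ] (+ n)    = K.trans (fromℤ-⊖ n (suc m)) (K.+-comm _ _)
  fromℤ-+ -[1+ m ] -[1+ n ] = begin
    - (suc (suc (m ℕ.+ n)) · 1#)         ≡⟨ ≡.cong (λ i → - (suc i · 1#)) (ℕ.+-suc m n) ⟨
    - ((suc m ℕ.+ suc n) · 1#)           ≈⟨ K.-‿cong (×-homo-+ 1# (suc m) (suc n)) ⟩
    - (suc m · 1# + suc n · 1#)          ≈⟨ -‿+-comm _ _ ⟨
    - (suc m · 1#) + - (suc n · 1#)      ∎

  fromℤ-neg : ∀ z → fromℤ K (ℤ.- z) K.≈ - fromℤ K z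
  fromℤ-neg (+ zero)   = K.sym -0#≈0#
  fromℤ-neg ℤ.+[1+ n ] = K.refl
  fromℤ-neg -[1+ n ]   = K.sym (-‿involutive _)

  AdditiveMap : (Γ : AbelianGroup a ℓ) → (AbelianGroup.Carrier Γ → K.Carrier) → Set _
  AdditiveMap Γ = GroupMorphisms.IsGroupHomomorphism
    (AbelianGroup.rawGroup Γ) (AbelianGroup.rawGroup +-abelianGroup)

  π⊗1-additive : {Γ : AbelianGroup a ℓ} (σ : Splitting Γ) →
                 ∀ j → AdditiveMap Γ (λ g → π⊗1 K σ g j)
  π⊗1-additive σ j = record
    { isMonoidHomomorphism = record
      { isMagmaHomomorphism = record
        { isRelHomomorphism = record
          { cong = λ g≈h → K.reflexive (≡.cong (fromℤ K) (proj₁ (⟦⟧-cong g≈h) j)) }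
        ; homo = λ g h → K.trans (K.reflexive (≡.cong (fromℤ K) (proj₁ (∙-homo g h) j)))
                                 (fromℤ-+ (Splitting.π σ g j) (Splitting.π σ h j))
        }
      ; ε-homo = K.reflexive (≡.cong (fromℤ K) (proj₁ ε-homo j))
      }
    ; ⁻¹-homo = λ g → K.trans (K.reflexive (≡.cong (fromℤ K) (proj₁ (⁻¹-homo g) j)))
                              (fromℤ-neg (Splitting.π σ g j))
    }
    where open GroupMorphisms.IsGroupIsomorphism (Splitting.isGroupIsomorphism σ)

  module _ (Γ : AbelianGroup a ℓ) where
    private module Γ = AbelianGroup Γ
    open RawMonoidDefinitions Γ.rawMonoid using () renaming (_×_ to _·ᴳ_)
    open AbelianGroupProperties Γ using (//-rightDividesˡ)

    module _ {h} (h-additive : AdditiveMap Γ h) where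
      open GroupMorphisms.IsGroupHomomorphism h-additive

      additive-multiple : ∀ n g → h (n ·ᴳ g) K.≈ n · 1# * h g
      additive-multiple n g = begin
        h (n ·ᴳ g)      ≈⟨ homo-multiple Γ.monoid +-monoid isMonoidHomomorphism n g ⟩
        n · h g         ≈⟨ ×-congʳ n (K.*-identityˡ (h g)) ⟨
        n · (1# * h g)  ≈⟨ ×-assoc-* n 1# (h g) ⟨
        n · 1# * h g    ∎

      additive-integerMultiple : ∀ z g → h (integerMultiple Γ z g) K.≈ fromℤ K z * h g
      additive-integerMultiple (+ n)    g = additive-multiple n g
      additive-integerMultiple -[1+ n ] g = begin
        h ((suc n ·ᴳ g) Γ.⁻¹)     ≈⟨ ⁻¹-homo _ ⟩
        - h (suc n ·ᴳ g)          ≈⟨ K.-‿cong (additive-multiple (suc n) g) ⟩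
        - (suc n · 1# * h g)      ≈⟨ -‿distribˡ-* _ _ ⟩
        - (suc n · 1#) * h g      ∎

      additive-combination : ∀ {d} (e : Vector Γ.Carrier d) (z : Vector ℤ d) →
        h (integerCombination Γ e z) K.≈ sum (λ k → fromℤ K (z k) * h (e k))
      additive-combination e z = K.trans
        (homo-sum Γ.monoid +-monoid isMonoidHomomorphism (λ k → integerMultiple Γ (z k) (e k)))
        (sum-cong-≋ λ k → additive-integerMultiple (z k) (e k))

      additive-difference : ∀ g c → h g K.≈ h (g Γ.∙ c Γ.⁻¹) + h c
      additive-difference g c = K.trans (⟦⟧-cong (Γ.sym (//-rightDividesˡ c g))) (homo _ _)

  module CharZero (char0 : CharacteristicZero K) where

    1#0 : 1# # 0#
    1#0 = HeytingCommutativeRingProperties.1#0 heytingCommutativeRing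

    fromℤ≈0⇒≡0 : ∀ z → fromℤ K z K.≈ 0# → z ≡ + 0
    fromℤ≈0⇒≡0 (+ zero)   z≈0 = ≡.refl
    fromℤ≈0⇒≡0 ℤ.+[1+ n ] z≈0 = contradiction (char0 n) (≈⇒¬# z≈0)
    fromℤ≈0⇒≡0 -[1+ n ]   z≈0 = contradiction (char0 n) (≈⇒¬# (begin
      suc n · 1#         ≈⟨ -‿involutive _ ⟨
      - - (suc n · 1#)   ≈⟨ K.-‿cong z≈0 ⟩
      - 0#               ≈⟨ -0#≈0# ⟩
      0#                 ∎))

    module _ {Γ : AbelianGroup a ℓ} (σ : Splitting Γ) where
      private module Γ = AbelianGroup Γ
      open RawMonoidDefinitions Γ.rawMonoid using () renaming (_×_ to _·ᴳ_)
      open Splitting σ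

      π⊗1-basisLift : ∀ k → π⊗1 K σ (basisLift σ k) ≃ unit k
      π⊗1-basisLift k j = begin
        fromℤ K (π (basisLift σ k) j)         ≡⟨ ≡.cong (fromℤ K) (π-basisLift σ k j) ⟩
        fromℤ K (indicator (+ 0) (+ 1) k j)   ≡⟨ map-indicator (fromℤ K) (+ 0) (+ 1) k j ⟩
        indicator 0# (1# + 0#) k j            ≈⟨ indicator-cong k j ⟩
        unit k j                              ∎
        where
        indicator-cong : ∀ {n} (k j : Fin n) → indicator 0# (1# + 0#) k j K.≈ unit k j
        indicator-cong zero    zero    = K.+-identityʳ 1#
        indicator-cong zero    (suc j) = K.refl
        indicator-cong (suc k) zero    = K.refl
        indicator-cong (suc k) (suc j) = indicator-cong k j

      remainder : Γ.Carrier → Γ.Carrier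
      remainder g = g Γ.∙ projection σ g Γ.⁻¹

      -- The computation takes place in `K`, where `additive-combination` shows that `g` and its
      -- projection have the same coordinates; characteristic zero brings the conclusion back to ℤ.
      π-remainder : ∀ g j → π (remainder g) j ≡ + 0
      π-remainder g j = fromℤ≈0⇒≡0 _ (+-cancelʳ (π⊗1 K σ g j) _ _ (begin
        π⊗1 K σ (remainder g) j + π⊗1 K σ g j
          ≈⟨ K.+-congˡ projection-fixes ⟨
        π⊗1 K σ (remainder g) j + π⊗1 K σ (projection σ g) j
          ≈⟨ additive-difference Γ (π⊗1-additive σ j) g (projection σ g) ⟨
        π⊗1 K σ g j
          ≈⟨ K.+-identityˡ _ ⟨
        0# + π⊗1 K σ g j  ∎))
        where
        projection-fixes : π⊗1 K σ (projection σ g) j K.≈ π⊗1 K σ g j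
        projection-fixes = begin
          π⊗1 K σ (projection σ g) j
            ≈⟨ additive-combination Γ (π⊗1-additive σ j) (basisLift σ) (π g) ⟩
          sum (λ k → π⊗1 K σ g k * π⊗1 K σ (basisLift σ k) j)
            ≈⟨ sum-cong-≋ (λ k → K.*-congˡ (π⊗1-basisLift k j)) ⟩
          sum (λ k → π⊗1 K σ g k * unit k j)
            ≈⟨ sum-unitʳ j (π⊗1 K σ g) ⟩
          π⊗1 K σ g j  ∎

      -- The remainder of `g` is torsion, so a positive integer times `h (remainder g)` is zero in
      -- `K`, and characteristic zero cancels the integer. What is left is the value of `h` on the
      -- projection.
      additive-factors : ∀ {h} → AdditiveMap Γ h → ∀ g →
                         h g K.≈ sum (λ k → π⊗1 K σ g k * h (basisLift σ k))
      additive-factors {h} h-additive g = begin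
        h g
          ≈⟨ additive-difference Γ h-additive g (projection σ g) ⟩
        h (remainder g) + h (projection σ g)
          ≈⟨ K.+-cong killed (additive-combination Γ h-additive (basisLift σ) (π g)) ⟩
        0# + sum (λ k → π⊗1 K σ g k * h (basisLift σ k))
          ≈⟨ K.+-identityˡ _ ⟩
        sum (λ k → π⊗1 K σ g k * h (basisLift σ k))  ∎
        where
        open GroupMorphisms.IsGroupHomomorphism h-additive
        killed : h (remainder g) K.≈ 0#
        killed with n , nt≈ε ← kernel⇒torsion σ (remainder g) (π-remainder g) =
          #0-cancels-0 (char0 n) (begin
            suc n · 1# * h (remainder g)  ≈⟨ additive-multiple Γ h-additive (suc n) (remainder g) ⟨
            h (suc n ·ᴳ remainder g)      ≈⟨ ⟦⟧-cong nt≈ε ⟩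
            h Γ.ε                         ≈⟨ ε-homo ⟩
            0#                            ∎)

-- Transport of indices, generated subgroups and spans

size-unique : {S : Setoid a ℓ} {S′ : Setoid b ℓ′} → Inverse S S′ →
              ∀ {m m′} → HasSize S m → HasSize S′ m′ → m ≡ m′
size-unique S≅S′ size size′ = Permutation.↔⇒≡
  (Composition.inverse (Symmetry.inverse size) (Composition.inverse S≅S′ size′))

module _ (Γ : AbelianGroup a ℓ) where

  generated-least : {S : Pred (AbelianGroup.Carrier Γ) p} (H : Subgroup Γ q) →
                    S ⊆ Subgroup.Member H → Generated Γ S ⊆ Subgroup.Member H
  generated-least H S⊆H (generator s)   = S⊆H s
  generated-least H S⊆H (respects e g∈) = Subgroup.resp H e (generated-least H S⊆H g∈)
  generated-least H S⊆H identity        = Subgroup.ε-closed H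
  generated-least H S⊆H (product g∈ h∈) =
    Subgroup.∙-closed H (generated-least H S⊆H g∈) (generated-least H S⊆H h∈)
  generated-least H S⊆H (inverse g∈)    = Subgroup.⁻¹-closed H (generated-least H S⊆H g∈)

module _ (K : HeytingField k k₁ k₂) where

  span-least : ∀ {d} {S : Pred (Vector (HeytingField.Carrier K) d) p} {T : Pred _ q} →
               S ⊆ Span K T → Span K S ⊆ Span K T
  span-least S⊆T (generator s)   = S⊆T s
  span-least S⊆T (respects e v∈) = respects e (span-least S⊆T v∈)
  span-least S⊆T zero            = zero
  span-least S⊆T (plus u∈ v∈)    = plus (span-least S⊆T u∈) (span-least S⊆T v∈)
  span-least S⊆T (scale c v∈)    = scale c (span-least S⊆T v∈)

  ⟨π⟩-mono : {Γ : AbelianGroup a ℓ} (σ : Splitting Γ)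
             {S : Pred (AbelianGroup.Carrier Γ) p} {T : Pred (AbelianGroup.Carrier Γ) q} →
             S ⊆ T → ⟨π_⟩ K σ S ⊆ ⟨π_⟩ K σ T
  ⟨π⟩-mono σ S⊆T = span-least λ (g , g∈S , u≃) → generator (g , S⊆T g∈S , u≃)

module _ {K : HeytingField k k₁ k₂} {Γ : AbelianGroup a ℓ} {Γ′ : AbelianGroup b ℓ′}
         {σ : Splitting Γ} {σ′ : Splitting Γ′}
         {n n′} {Y : Vector (AbelianGroup.Carrier Γ) n} {Y′ : Vector (AbelianGroup.Carrier Γ′) n′}
         (D : RankAndMultiplicity K σ Y) (D′ : RankAndMultiplicity K σ′ Y′) where
  private
    module Γ  = AbelianGroup Γ
    module Γ′ = AbelianGroup Γ′
    module D  = RankAndMultiplicity D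
    module D′ = RankAndMultiplicity D′

  -- A bijection of quotient setoids, unfolded: two elements of a saturation are equal when their
  -- difference is generated. Both uses take `to` and `from` to be `id`, because a quotient group
  -- keeps the carrier of the group.
  multiplicity-transfer : ∀ A A′ →
    let S  = members Γ Y A
        S′ = members Γ′ Y′ A′
    in
    (to : Γ.Carrier → Γ′.Carrier) (from : Γ′.Carrier → Γ.Carrier) →
    (∀ {g} → saturation K σ S g → saturation K σ′ S′ (to g)) →
    (∀ {g} → saturation K σ′ S′ g → saturation K σ S (from g)) →
    (∀ {g h} → Generated Γ S (g Γ.∙ h Γ.⁻¹) → Generated Γ′ S′ (to g Γ′.∙ to h Γ′.⁻¹)) →
    (∀ {g h} → Generated Γ′ S′ (g Γ′.∙ h Γ′.⁻¹) → Generated Γ S (from g Γ.∙ from h Γ.⁻¹)) →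
    (∀ {g h} → Generated Γ S (h Γ.∙ from g Γ.⁻¹) → Generated Γ′ S′ (to h Γ′.∙ g Γ′.⁻¹)) →
    (∀ {g h} → Generated Γ′ S′ (h Γ′.∙ to g Γ′.⁻¹) → Generated Γ S (from h Γ.∙ g Γ.⁻¹)) →
    D.m A ≡ D′.m A′
  multiplicity-transfer A A′ to from sat-to sat-from to-cong from-cong inverseˡ inverseʳ =
    size-unique (record
      { to        = λ (g , g∈) → to g , sat-to g∈
      ; from      = λ (g , g∈) → from g , sat-from g∈
      ; to-cong   = to-cong
      ; from-cong = from-cong
      ; inverse   = inverseˡ , inverseʳ
      }) (D.m-index A) (D′.m-index A′)

-- Passing from Γ to Γ/⟨λ⟩

module Contraction
  (K : HeytingField k k₁ k₂) (char0 : CharacteristicZero K)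
  (Γ : AbelianGroup a ℓ) (σ : Splitting Γ) (l : AbelianGroup.Carrier Γ)
  (σ₂ : Splitting (_/_ Γ (⟨ Γ ⟩₁ l)))
  where

  Γ/l : AbelianGroup _ _
  Γ/l = _/_ Γ (⟨ Γ ⟩₁ l)

  private
    module K = HeytingField K
    module Γ = AbelianGroup Γ
    module Γ/l = AbelianGroup Γ/l
  open K using (_+_; _*_; -_; _-_; 0#; 1#; heytingCommutativeRing)
  open HeytingCommutativeRing heytingCommutativeRing using (commutativeRing)
  open CommutativeRing commutativeRing using (ring; semiring; setoid; +-rawMonoid)
  open RawMonoidDefinitions +-rawMonoid using () renaming (_×_ to _·_)
  open RawMonoidDefinitions Γ.rawMonoid using () renaming (_×_ to _·ᴳ_)
  open RawMonoidDefinitions Γ/l.rawMonoid using () renaming (_×_ to _·ᴳ/l_)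
  open RingProperties ring using (-‿distribˡ-*; //-rightDividesˡ)
  open SemiringSum semiring using (sum; sum-cong-≋; ∑-distrib-+; *-distribʳ-sum)
  open AbelianGroupProperties Γ
    using (ε⁻¹≈ε) renaming (//-rightDividesˡ to ∙-//-rightDividesˡ)
  open LinearAlgebra K
  open OverField K
  open CharZero char0
  open SetoidReasoning setoid
  open GroupMorphisms.IsGroupHomomorphism using (⟦⟧-cong; homo; ⁻¹-homo; ε-homo)

  λ⊗1 : Vector K.Carrier (Splitting.rank σ)
  λ⊗1 = π⊗1 K σ l

  ≈⇒≈/l : ∀ {g h} → g Γ.≈ h → g Γ/l.≈ h
  ≈⇒≈/l g≈h = respects (Γ.sym (Γ.trans (Γ.∙-congʳ g≈h) (Γ.inverseʳ _))) identity

  l≈ε/l : l Γ/l.≈ Γ.ε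
  l≈ε/l = generator (Γ.trans (Γ.∙-congˡ ε⁻¹≈ε) (Γ.identityʳ l))

  -- The two recursions run over different monoid structures, so these equalities are not
  -- definitional.
  multiple-/l : ∀ n g → n ·ᴳ/l g ≡ n ·ᴳ g
  multiple-/l zero    g = ≡.refl
  multiple-/l (suc n) g = ≡.cong (g Γ.∙_) (multiple-/l n g)

  integerMultiple-/l : ∀ z g → integerMultiple Γ/l z g ≡ integerMultiple Γ z g
  integerMultiple-/l (+ n)    g = multiple-/l n g
  integerMultiple-/l -[1+ n ] g = ≡.cong Γ._⁻¹ (multiple-/l (suc n) g)

  integerCombination-/l : ∀ {d} (e : Vector Γ.Carrier d) z →
                          integerCombination Γ/l e z ≡ integerCombination Γ e z
  integerCombination-/l e z = MonoidSum.sum-cong-≗ Γ.monoid λ k → integerMultiple-/l (z k) (e k)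

  π₂⊗1-additive : ∀ j → AdditiveMap Γ (λ g → π⊗1 K σ₂ g j)
  π₂⊗1-additive j = record
    { isMonoidHomomorphism = record
      { isMagmaHomomorphism = record
        { isRelHomomorphism = record { cong = λ g≈h → ⟦⟧-cong π₂ (≈⇒≈/l g≈h) }
        ; homo = homo π₂
        }
      ; ε-homo = ε-homo π₂
      }
    ; ⁻¹-homo = ⁻¹-homo π₂
    }
    where π₂ = π⊗1-additive σ₂ j

  P : Vector (Vector K.Carrier (Splitting.rank σ₂)) (Splitting.rank σ)
  P k = π⊗1 K σ₂ (basisLift σ k)

  Q : Vector (Vector K.Carrier (Splitting.rank σ)) (Splitting.rank σ₂)
  Q k = π⊗1 K σ (basisLift σ₂ k)

  P-π⊗1 : ∀ g → combination P (π⊗1 K σ g) ≃ π⊗1 K σ₂ g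
  P-π⊗1 g j = K.sym (additive-factors σ (π₂⊗1-additive j) g)

  P-λ : combination P λ⊗1 ≃ λ _ → 0#
  P-λ j = K.trans (P-π⊗1 l j)
    (K.trans (⟦⟧-cong (π⊗1-additive σ₂ j) l≈ε/l) (ε-homo (π⊗1-additive σ₂ j)))

  -- The elements whose image lies on `K`·π(λ). Packaged as a subgroup so that `generated-least` can
  -- extract a scalar from a proof of membership in ⟨λ⟩.
  line : Subgroup Γ _
  line = record
    { Member    = λ g → ∃ λ c → π⊗1 K σ g ≃ λ j → c * λ⊗1 j
    ; resp      = λ g≈h (c , e) → c , λ j → K.trans (⟦⟧-cong (π⊗1-additive σ j) (Γ.sym g≈h)) (e j)
    ; ε-closed  = 0# , λ j → K.trans (ε-homo (π⊗1-additive σ j)) (K.sym (K.zeroˡ _))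
    ; ∙-closed  = λ (c , e) (c′ , e′) → c + c′ , λ j →
        K.trans (homo (π⊗1-additive σ j) _ _)
          (K.trans (K.+-cong (e j) (e′ j)) (K.sym (K.distribʳ _ _ _)))
    ; ⁻¹-closed = λ (c , e) → - c , λ j →
        K.trans (⁻¹-homo (π⊗1-additive σ j) _)
          (K.trans (K.-‿cong (e j)) (-‿distribˡ-* _ _))
    }

  -- Modulo λ the remainder `t` of `g` is torsion, so a positive multiple of `t` lies in ⟨λ⟩. Hence
  -- a positive multiple of its image is `c` times `λ⊗1`, and dividing in `K` places the image
  -- itself on the line.
  QP-π⊗1 : ∀ g → ∃ λ c → π⊗1 K σ g ≃ λ j → combination Q (π⊗1 K σ₂ g) j + c * λ⊗1 j
  QP-π⊗1 g with n , nt≈ε ← kernel⇒torsion σ₂ (remainder σ₂ g) (π-remainder σ₂ g)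
    -- `nt≈ε` is an equality in the quotient, so by definition it is a membership in ⟨λ⟩; the
    -- generator itself has scalar `1#`.
    with c , π[nt]≃cλ ← generated-least Γ line
           (λ h≈l → 1# , λ j → K.trans (⟦⟧-cong (π⊗1-additive σ j) h≈l) (K.sym (K.*-identityˡ _)))
           nt≈ε
    = n⁻¹ * c , λ j → begin
      π⊗1 K σ g j
        ≈⟨ additive-difference Γ (π⊗1-additive σ j) g (projection σ₂ g) ⟩
      π⊗1 K σ t j + π⊗1 K σ (projection σ₂ g) j
        ≈⟨ K.+-cong (πt≃ j)
             (K.trans (K.reflexive (≡.cong (λ h → π⊗1 K σ h j) (integerCombination-/l (basisLift σ₂) z)))
                      (additive-combination Γ (π⊗1-additive σ j) (basisLift σ₂) z)) ⟩
      (n⁻¹ * c) * λ⊗1 j + combination Q (π⊗1 K σ₂ g) j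
        ≈⟨ K.+-comm _ _ ⟩
      combination Q (π⊗1 K σ₂ g) j + (n⁻¹ * c) * λ⊗1 j  ∎
    where
    t = remainder σ₂ g
    z = Splitting.π σ₂ g
    n⁻¹ = proj₁ (#0⇒inverse (char0 n))
    nt≈ : (suc n ·ᴳ/l t) Γ.∙ Γ.ε Γ.⁻¹ Γ.≈ suc n ·ᴳ t
    nt≈ = Γ.trans (Γ.∙-congˡ ε⁻¹≈ε) (Γ.trans (Γ.identityʳ _) (Γ.reflexive (multiple-/l (suc n) t)))
    πt≃ : ∀ j → π⊗1 K σ t j K.≈ (n⁻¹ * c) * λ⊗1 j
    πt≃ j = K.trans
      (cancel-#0 (char0 n) (begin
        suc n · 1# * π⊗1 K σ t j                 ≈⟨ additive-multiple Γ (π⊗1-additive σ j) (suc n) t ⟨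
        π⊗1 K σ (suc n ·ᴳ t) j                   ≈⟨ ⟦⟧-cong (π⊗1-additive σ j) nt≈ ⟨
        π⊗1 K σ ((suc n ·ᴳ/l t) Γ.∙ Γ.ε Γ.⁻¹) j  ≈⟨ π[nt]≃cλ j ⟩
        c * λ⊗1 j                                ∎))
      (K.sym (K.*-assoc _ _ _))

  -- Linear extension of `QP-π⊗1`: the images of the lifts `basisLift σ k` are the standard basis,
  -- so the scalar for `v` is the sum of theirs weighted by the entries of `v`.
  QP : ∀ v → ∃ λ c → v ≃ λ j → combination Q (combination P v) j + c * λ⊗1 j
  QP v = sum (λ k → v k * coeff k) , λ j → begin
    v j
      ≈⟨ sum-unitʳ j v ⟨
    sum (λ k → v k * unit k j)
      ≈⟨ sum-cong-≋ (λ k → K.*-congˡ (K.trans (K.sym (π⊗1-basisLift σ k j))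
                                              (proj₂ (QP-π⊗1 (basisLift σ k)) j))) ⟩
    sum (λ k → v k * (combination Q (P k) j + coeff k * λ⊗1 j))
      ≈⟨ sum-cong-≋ (λ k → K.trans (K.distribˡ (v k) _ _)
                                   (K.+-congˡ (K.sym (K.*-assoc (v k) (coeff k) (λ⊗1 j))))) ⟩
    sum (λ k → v k * combination Q (P k) j + (v k * coeff k) * λ⊗1 j)
      ≈⟨ ∑-distrib-+ (λ k → v k * combination Q (P k) j) (λ k → (v k * coeff k) * λ⊗1 j) ⟩
    combination (combination Q ∘ P) v j + sum (λ k → (v k * coeff k) * λ⊗1 j)
      ≈⟨ K.+-cong (combination-combination Q P v j) (*-distribʳ-sum (λ⊗1 j) (λ k → v k * coeff k)) ⟨
    combination Q (combination P v) j + sum (λ k → v k * coeff k) * λ⊗1 j  ∎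
    where
    coeff : Vector K.Carrier _
    coeff k = proj₁ (QP-π⊗1 (basisLift σ k))

  -- The kernel of `P` lies on the line of λ: the parts of `v` and `v′` that factor through `P`
  -- agree, leaving the difference of the two scalars supplied by `QP`.
  fibre : ∀ v v′ → combination P v ≃ combination P v′ →
          ∃ λ c → v ≃ λ j → v′ j + c * λ⊗1 j
  fibre v v′ Pv≃Pv′ = c - c′ , λ j → begin
    v j
      ≈⟨ proj₂ (QP v) j ⟩
    combination Q (combination P v) j + c * λ⊗1 j
      ≈⟨ K.+-cong (combination-cong Q Pv≃Pv′ j) (K.*-congʳ c≈c′+[c-c′]) ⟩
    combination Q (combination P v′) j + (c′ + (c - c′)) * λ⊗1 j
      ≈⟨ K.+-congˡ (K.distribʳ (λ⊗1 j) c′ (c - c′)) ⟩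
    combination Q (combination P v′) j + (c′ * λ⊗1 j + (c - c′) * λ⊗1 j)
      ≈⟨ K.+-assoc _ _ _ ⟨
    (combination Q (combination P v′) j + c′ * λ⊗1 j) + (c - c′) * λ⊗1 j
      ≈⟨ K.+-congʳ (proj₂ (QP v′) j) ⟨
    v′ j + (c - c′) * λ⊗1 j  ∎
    where
    c  = proj₁ (QP v)
    c′ = proj₁ (QP v′)
    c≈c′+[c-c′] : c K.≈ c′ + (c - c′)
    c≈c′+[c-c′] = K.sym (K.trans (K.+-comm c′ (c - c′)) (//-rightDividesˡ c′ c))

  -- The hypotheses describe `S` as `S₁` together with λ, and `S₂` as the image of `S₁` in the
  -- quotient, up to the respective equalities.
  module Contracted {S₁ S : Pred Γ.Carrier p} {S₂ : Pred Γ.Carrier q}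
    (S₁⊆S : S₁ ⊆ S) (l∈S : S l) (S⊆S₁∪l : ∀ {g} → S g → g Γ.≈ l ⊎ S₁ g)
    (S₁⊆S₂ : S₁ ⊆ S₂) (S₂⊆S₁ : ∀ {g} → S₂ g → ∃ λ h → S₁ h × g Γ/l.≈ h)
    where

    private
      V : Pred (Vector K.Carrier (Splitting.rank σ)) _
      V = ⟨π_⟩ K σ S
      V₂ : Pred (Vector K.Carrier (Splitting.rank σ₂)) _
      V₂ = ⟨π_⟩ K σ₂ S₂

    λ∈V : V λ⊗1
    λ∈V = generator (l , l∈S , λ j → K.refl)

    push : ∀ {v} → V v → V₂ (combination P v)
    push (generator (g , g∈S , u≃πg)) with S⊆S₁∪l g∈S
    ... | inj₁ g≈l = respects
      (λ j → K.sym (K.trans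
        (combination-cong P (λ i → K.trans (u≃πg i) (⟦⟧-cong (π⊗1-additive σ i) g≈l)) j)
        (P-λ j)))
      zero
    ... | inj₂ g∈S₁ = generator
      (g , S₁⊆S₂ g∈S₁ , λ j → K.trans (combination-cong P u≃πg j) (P-π⊗1 g j))
    push (respects u≃v u∈V) = respects (combination-cong P u≃v) (push u∈V)
    push zero               = respects (λ j → K.sym (combination-0 P j)) zero
    push (plus u∈V v∈V)     = respects (λ j → K.sym (combination-+ P _ _ j)) (plus (push u∈V) (push v∈V))
    push (scale c u∈V)      = respects (λ j → K.sym (combination-* P c _ j)) (scale c (push u∈V))

    pull : ∀ {w} → V₂ w → ∃ λ v → V v × combination P v ≃ w
    pull (generator (g , g∈S₂ , u≃πg)) with h , h∈S₁ , g≈h ← S₂⊆S₁ g∈S₂ =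
      π⊗1 K σ h , generator (h , S₁⊆S h∈S₁ , λ j → K.refl) , λ j →
        K.trans (P-π⊗1 h j) (K.sym (K.trans (u≃πg j) (⟦⟧-cong (π⊗1-additive σ₂ j) g≈h)))
    pull (respects u≃w u∈V₂) with v , v∈V , Pv≃u ← pull u∈V₂ =
      v , v∈V , λ j → K.trans (Pv≃u j) (u≃w j)
    pull zero = _ , zero , combination-0 P
    pull (plus u∈V₂ w∈V₂) with v , v∈V , Pv≃u ← pull u∈V₂ | v′ , v′∈V , Pv′≃w ← pull w∈V₂ =
      _ , plus v∈V v′∈V , λ j → K.trans (combination-+ P v v′ j) (K.+-cong (Pv≃u j) (Pv′≃w j))
    pull (scale c u∈V₂) with v , v∈V , Pv≃u ← pull u∈V₂ =
      _ , scale c v∈V , λ j → K.trans (combination-* P c v j) (K.*-congˡ (Pv≃u j))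

    saturation-push : saturation K σ S ⊆ saturation K σ₂ S₂
    saturation-push {g} g∈ = respects (P-π⊗1 g) (push g∈)

    -- `pull` yields only some `v` in the span with the same image under `P` as `π⊗1 K σ g`. The two
    -- differ by a multiple of `λ⊗1`, which the span contains because λ is in `S`.
    saturation-pull : saturation K σ₂ S₂ ⊆ saturation K σ S
    saturation-pull {g} g∈ =
      let v , v∈V , Pv≃πg = pull g∈
          c , πg≃         = fibre (π⊗1 K σ g) v λ j → K.trans (P-π⊗1 g j) (K.sym (Pv≃πg j))
      in respects (λ j → K.sym (πg≃ j)) (plus v∈V (scale c λ∈V))

    generated-push : Generated Γ S ⊆ Generated Γ/l S₂
    generated-push (generator s) with S⊆S₁∪l s
    ... | inj₁ g≈l  = respects (Γ/l.sym (Γ/l.trans (≈⇒≈/l g≈l) l≈ε/l)) identity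
    ... | inj₂ g∈S₁ = generator (S₁⊆S₂ g∈S₁)
    generated-push (respects g≈h g∈) = respects (≈⇒≈/l g≈h) (generated-push g∈)
    generated-push identity          = identity
    generated-push (product g∈ h∈)   = product (generated-push g∈) (generated-push h∈)
    generated-push (inverse g∈)      = inverse (generated-push g∈)

    -- Write `g` as `(g ∙ h ⁻¹) ∙ h`: the first factor lies in ⟨λ⟩, which ⟨S⟩ contains.
    generated-resp-/l : ∀ {g h} → g Γ/l.≈ h → Generated Γ S h → Generated Γ S g
    generated-resp-/l {g} {h} g≈h h∈ = respects (∙-//-rightDividesˡ h g) (product
      (generated-least Γ (⟨ Γ ⟩ S) (λ g≈l → respects (Γ.sym g≈l) (generator l∈S)) g≈h) h∈)

    generated-pull : Generated Γ/l S₂ ⊆ Generated Γ S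
    generated-pull (generator s) with h , h∈S₁ , g≈h ← S₂⊆S₁ s =
      generated-resp-/l g≈h (generator (S₁⊆S h∈S₁))
    generated-pull (respects g≈h g∈) = generated-resp-/l (Γ/l.sym g≈h) (generated-pull g∈)
    generated-pull identity          = identity
    generated-pull (product g∈ h∈)   = product (generated-pull g∈) (generated-pull h∈)
    generated-pull (inverse g∈)      = inverse (generated-pull g∈)

    module _ {r r₂} (dim : HasDimension K V r) (dim₂ : HasDimension K V₂ r₂) where
      private
        module B  = HasDimension dim
        module B₂ = HasDimension dim₂

      -- By `QP` every basis vector of `V` is a multiple of `λ⊗1` plus the `Q`-image of a vector of
      -- `V₂`, so `λ⊗1` and the `Q`-images of a basis of `V₂` suffice to express it.
      dimension-contraction-≤ : r ≤ suc r₂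
      dimension-contraction-≤ =
        exchange 1#0 {b′ = λ⊗1 Vector.∷ combination Q ∘ B₂.basis} B.independent λ i →
        let s , Bs≃Pb = span⇒combination B₂.basis (B₂.spanning (push (B.inside i)))
            c , b≃    = QP (B.basis i)
        in c Vector.∷ s , λ j → begin
          c * λ⊗1 j + combination (combination Q ∘ B₂.basis) s j
            ≈⟨ K.+-comm _ _ ⟩
          combination (combination Q ∘ B₂.basis) s j + c * λ⊗1 j
            ≈⟨ K.+-congʳ (combination-combination Q B₂.basis s j) ⟨
          combination Q (combination B₂.basis s) j + c * λ⊗1 j
            ≈⟨ K.+-congʳ (combination-cong Q Bs≃Pb j) ⟩
          combination Q (combination P (B.basis i)) j + c * λ⊗1 j
            ≈⟨ b≃ j ⟨
          B.basis i j  ∎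

      module _ (πl≢0 : ¬ (∀ j → Splitting.π σ l j ≡ + 0)) where

        private
          lifted : Vector (Vector K.Carrier (Splitting.rank σ)) (suc r₂)
          lifted = λ⊗1 Vector.∷ λ i → proj₁ (pull (B₂.inside i))

          lifted∈V : ∀ i → V (lifted i)
          lifted∈V zero    = λ∈V
          lifted∈V (suc i) = proj₁ (proj₂ (pull (B₂.inside i)))

          -- Applying `P` removes the `λ⊗1` term and turns the other vectors into the basis of `V₂`,
          -- so their coefficients vanish. The relation then reduces to a multiple of `λ⊗1`.
          lifted-independent : Independent lifted
          lifted-independent s s≃0 = λ { zero → s₀≈0 ; (suc i) → tail≈0 i }
            where
            tail≈0 : ∀ i → s (suc i) K.≈ 0#
            tail≈0 = B₂.independent (tail s) λ j → begin
              combination B₂.basis (tail s) j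
                ≈⟨ combination-congˡ _ (λ i → proj₂ (proj₂ (pull (B₂.inside i)))) (tail s) j ⟨
              combination (combination P ∘ tail lifted) (tail s) j
                ≈⟨ K.+-identityˡ _ ⟨
              0# + combination (combination P ∘ tail lifted) (tail s) j
                ≈⟨ K.+-congʳ (K.trans (K.*-congˡ (P-λ j)) (K.zeroʳ _)) ⟨
              combination (combination P ∘ lifted) s j
                ≈⟨ combination-combination P lifted s j ⟨
              combination P (combination lifted s) j
                ≈⟨ combination-cong P s≃0 j ⟩
              combination P (λ _ → 0#) j
                ≈⟨ combination-0 P j ⟩
              0#  ∎

            s₀λ≈0 : ∀ j → s zero * λ⊗1 j K.≈ 0#
            s₀λ≈0 j = begin
              s zero * λ⊗1 j
                ≈⟨ K.+-identityʳ _ ⟨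
              s zero * λ⊗1 j + 0#
                ≈⟨ K.+-congˡ (sum-zero λ i → K.trans (K.*-congʳ (tail≈0 i))
                                                     (K.zeroˡ (lifted (suc i) j))) ⟨
              combination lifted s j
                ≈⟨ s≃0 j ⟩
              0#  ∎

            s₀≈0 : s zero K.≈ 0#
            -- No particular coordinate of π(λ) is known to be nonzero. If the scalar were apart
            -- from zero, it would cancel in every coordinate at once and make π(λ) zero; tightness
            -- then gives equality.
            s₀≈0 = ¬#⇒≈ λ s₀#0 → πl≢0 λ j →
              fromℤ≈0⇒≡0 _ (#0-cancels-0 s₀#0 (s₀λ≈0 j))

        dimension-contraction : r ≡ suc r₂
        dimension-contraction = ℕ.≤-antisym dimension-contraction-≤
          (exchange 1#0 lifted-independent λ i →
            span⇒combination B.basis (B.spanning (lifted∈V i)))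

-- Subsets with one position inserted

module _ (Γ : AbelianGroup a ℓ) {n} (X : Vector (AbelianGroup.Carrier Γ) (suc n))
         (i : Fin (suc n)) (A : Subset n) where
  open AbelianGroup Γ using (_≈_; trans; reflexive)

  members-insertAt⁺ : ∀ b → members Γ (removeAt X i) A ⊆ members Γ X (Vec.insertAt A i b)
  members-insertAt⁺ b (j , j∈A , g≈) = punchIn i j , Vec.lookup⇒[]= _ _
    (≡.trans (Vec.insertAt-punchIn A i b j) (Vec.[]=⇒lookup j∈A)) , g≈

  members-insertAt⁻ : ∀ b {g} → members Γ X (Vec.insertAt A i b) g →
                      (b ≡ true × g ≈ X i) ⊎ members Γ (removeAt X i) A g
  members-insertAt⁻ b (j , j∈ , g≈) with i ≟ j
  ... | yes ≡.refl =
    inj₁ (≡.trans (≡.sym (Vec.insertAt-lookup A i b)) (Vec.[]=⇒lookup j∈) , g≈)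
  ... | no i≢j = inj₂
    ( punchOut i≢j
    , Vec.lookup⇒[]= _ _ (begin
        Vec.lookup A (punchOut i≢j)
          ≡⟨ Vec.insertAt-punchIn A i b (punchOut i≢j) ⟨
        Vec.lookup (Vec.insertAt A i b) (punchIn i (punchOut i≢j))
          ≡⟨ ≡.cong (Vec.lookup (Vec.insertAt A i b)) (punchIn-punchOut i≢j) ⟩
        Vec.lookup (Vec.insertAt A i b) j
          ≡⟨ Vec.[]=⇒lookup j∈ ⟩
        true  ∎)
    , trans g≈ (reflexive (≡.cong X (≡.sym (punchIn-punchOut i≢j))))
    )
    where open ≡.≡-Reasoning

  members-insertAt-false : members Γ X (Vec.insertAt A i false) ⊆ members Γ (removeAt X i) A
  members-insertAt-false g∈ with members-insertAt⁻ false g∈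
  ... | inj₂ g∈X₁ = g∈X₁

  members-insertAt-true : ∀ {g} → members Γ X (Vec.insertAt A i true) g →
                          g ≈ X i ⊎ members Γ (removeAt X i) A g
  members-insertAt-true g∈ with members-insertAt⁻ true g∈
  ... | inj₁ (_ , g≈) = inj₁ g≈
  ... | inj₂ g∈X₁     = inj₂ g∈X₁

  lookup-member-insertAt : members Γ X (Vec.insertAt A i true) (X i)
  lookup-member-insertAt =
    i , Vec.lookup⇒[]= _ _ (Vec.insertAt-lookup A i true) , AbelianGroup.refl Γ

insertAt-⊤ : ∀ {n} (i : Fin (suc n)) → Vec.insertAt ⊤ i true ≡ ⊤
insertAt-⊤         zero    = ≡.refl
insertAt-⊤ {suc n} (suc i) = ≡.cong (true Vec.∷_) (insertAt-⊤ i)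

∣insertAt-false∣ : ∀ {n} (A : Subset n) i → ∣ Vec.insertAt A i false ∣ ≡ ∣ A ∣
∣insertAt-false∣ A               zero    = ≡.refl
∣insertAt-false∣ (false Vec.∷ A) (suc i) = ∣insertAt-false∣ A i
∣insertAt-false∣ (true Vec.∷ A)  (suc i) = ≡.cong suc (∣insertAt-false∣ A i)

∣insertAt-true∣ : ∀ {n} (A : Subset n) i → ∣ Vec.insertAt A i true ∣ ≡ suc ∣ A ∣
∣insertAt-true∣ A               zero    = ≡.refl
∣insertAt-true∣ (false Vec.∷ A) (suc i) = ∣insertAt-true∣ A i
∣insertAt-true∣ (true Vec.∷ A)  (suc i) = ≡.cong suc (∣insertAt-true∣ A i)

-- Sums of polynomials, coefficient by coefficient

module _ (R : RawRing a ℓ)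
         (identityˡ : ∀ r → RawRing._+_ R (RawRing.0# R) r ≡ r)
         (identityʳ : ∀ r → RawRing._+_ R r (RawRing.0# R) ≡ r) where
  open RawRing R using (_+_)

  -- Beyond the end of the shorter list the sum copies the longer one, while the absent coefficient
  -- reads as `0#`; the identity laws reconcile the two.
  coefficient-+ : ∀ f g i →
    coefficient R (addPolynomials R f g) i ≡ coefficient R f i + coefficient R g i
  coefficient-+ []      g       i       =
    ≡.trans (≡.cong (λ h → coefficient R h i) (map-id g)) (≡.sym (identityˡ _))
  coefficient-+ (r ∷ f) []      i       =
    ≡.trans (≡.cong (λ h → coefficient R h i) (map-id (r ∷ f))) (≡.sym (identityʳ _))
  coefficient-+ (r ∷ f) (s ∷ g) zero    = ≡.refl
  coefficient-+ (r ∷ f) (s ∷ g) (suc i) = coefficient-+ f g i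

open RawRing ℤ[x,y] using () renaming (Carrier to ℤ[X,Y]; _+_ to infixl 6 _⊕_)

-- The outer list is indexed by powers of y, so `i` is the exponent of y and `j` that of x.
coefficient₂ : ℤ[X,Y] → ℕ → ℕ → ℤ
coefficient₂ f i j = coefficient ℤ.+-*-rawRing (coefficient ℤ[x] f i) j

coefficient₂-+ : ∀ f g i j →
                 coefficient₂ (f ⊕ g) i j ≡ coefficient₂ f i j ℤ.+ coefficient₂ g i j
coefficient₂-+ f g i j = ≡.trans
  (≡.cong (λ h → coefficient ℤ.+-*-rawRing h j)
    (coefficient-+ ℤ[x] map-id (λ { [] → ≡.refl ; h@(_ ∷ _) → map-id h }) f g i))
  (coefficient-+ ℤ.+-*-rawRing ℤ.+-identityˡ ℤ.+-identityʳ
    (coefficient ℤ[x] f i) (coefficient ℤ[x] g i) j)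

sumOverSubsets-cong : ∀ {n} {f g : Subset n → ℤ[X,Y]} → (∀ A → f A ≡ g A) →
                      sumOverSubsets f ≡ sumOverSubsets g
sumOverSubsets-cong {zero}  f≗g = f≗g Vec.[]
sumOverSubsets-cong {suc n} f≗g = ≡.cong₂ _⊕_
  (sumOverSubsets-cong (λ A → f≗g (false Vec.∷ A)))
  (sumOverSubsets-cong (λ A → f≗g (true Vec.∷ A)))

-- The recursion splits at the head, whereas position `i` may lie deeper. The four resulting sums
-- must be regrouped, and working with coefficients makes this an interchange in ℤ.
sumOverSubsets-insertAt : ∀ {n} (i : Fin (suc n)) (f : Subset (suc n) → ℤ[X,Y]) s t →
  coefficient₂ (sumOverSubsets f) s t ≡
  coefficient₂ (sumOverSubsets (λ A → f (Vec.insertAt A i false)) ⊕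
                sumOverSubsets (λ A → f (Vec.insertAt A i true))) s t
sumOverSubsets-insertAt         zero    f s t = ≡.refl
sumOverSubsets-insertAt {suc n} (suc i) f s t = begin
  ⟦ Σ f₀ ⊕ Σ f₁ ⟧
    ≡⟨ coefficient₂-+ (Σ f₀) (Σ f₁) s t ⟩
  ⟦ Σ f₀ ⟧ ℤ.+ ⟦ Σ f₁ ⟧
    ≡⟨ ≡.cong₂ ℤ._+_
         (≡.trans (sumOverSubsets-insertAt i f₀ s t) (coefficient₂-+ (Σ f₀₀) (Σ f₀₁) s t))
         (≡.trans (sumOverSubsets-insertAt i f₁ s t) (coefficient₂-+ (Σ f₁₀) (Σ f₁₁) s t)) ⟩
  (⟦ Σ f₀₀ ⟧ ℤ.+ ⟦ Σ f₀₁ ⟧) ℤ.+ (⟦ Σ f₁₀ ⟧ ℤ.+ ⟦ Σ f₁₁ ⟧)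
    ≡⟨ interchange ⟦ Σ f₀₀ ⟧ ⟦ Σ f₀₁ ⟧ ⟦ Σ f₁₀ ⟧ ⟦ Σ f₁₁ ⟧ ⟩
  (⟦ Σ f₀₀ ⟧ ℤ.+ ⟦ Σ f₁₀ ⟧) ℤ.+ (⟦ Σ f₀₁ ⟧ ℤ.+ ⟦ Σ f₁₁ ⟧)
    ≡⟨ ≡.cong₂ ℤ._+_ (coefficient₂-+ (Σ f₀₀) (Σ f₁₀) s t) (coefficient₂-+ (Σ f₀₁) (Σ f₁₁) s t) ⟨
  ⟦ Σ f₀₀ ⊕ Σ f₁₀ ⟧ ℤ.+ ⟦ Σ f₀₁ ⊕ Σ f₁₁ ⟧
    ≡⟨ coefficient₂-+ (Σ f₀₀ ⊕ Σ f₁₀) (Σ f₀₁ ⊕ Σ f₁₁) s t ⟨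
  ⟦ (Σ f₀₀ ⊕ Σ f₁₀) ⊕ (Σ f₀₁ ⊕ Σ f₁₁) ⟧  ∎
  where
  open ≡.≡-Reasoning
  open CommutativeSemigroupProperties ℤ.+-commutativeSemigroup using (interchange)
  Σ : ∀ {n} → (Subset n → ℤ[X,Y]) → ℤ[X,Y]
  Σ = sumOverSubsets
  ⟦_⟧ : ℤ[X,Y] → ℤ
  ⟦ g ⟧ = coefficient₂ g s t
  f₀ f₁ : Subset (suc n) → ℤ[X,Y]
  f₀ A = f (false Vec.∷ A)
  f₁ A = f (true Vec.∷ A)
  f₀₀ f₀₁ f₁₀ f₁₁ : Subset n → ℤ[X,Y]
  f₀₀ A = f₀ (Vec.insertAt A i false)
  f₀₁ A = f₀ (Vec.insertAt A i true)
  f₁₀ A = f₁ (Vec.insertAt A i false)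
  f₁₁ A = f₁ (Vec.insertAt A i true)

tutteTerm : ℕ → ℕ → ℕ → ℤ[X,Y]
tutteTerm m d e = m · ((x + - 1#) ^ d * (y + - 1#) ^ e)
  where
  open RawRing ℤ[x,y]
  open RawSemiringDefinitions rawSemiring using (_^_) renaming (_×_ to _·_)

-- A term sees its subset only through three numbers, so matching these gives propositionally equal
-- polynomials and spares any arithmetic with powers.
tutteTerm-cong : ∀ {m m′ d d′ e e′} → m ≡ m′ → d ≡ d′ → e ≡ e′ →
                 tutteTerm m d e ≡ tutteTerm m′ d′ e′
tutteTerm-cong ≡.refl ≡.refl ≡.refl = ≡.refl

module _ {K : HeytingField k k₁ k₂} {Γ : AbelianGroup a ℓ} {σ : Splitting Γ}
         {n : ℕ} {Y : Vector (AbelianGroup.Carrier Γ) n} (D : RankAndMultiplicity K σ Y) where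
  open RankAndMultiplicity D

  term : Subset n → ℤ[X,Y]
  term A = tutteTerm (m A) (r ⊤ ∸ r A) (∣ A ∣ ∸ r A)

  multiplicityTutte-terms : multiplicityTutte D ≡ sumOverSubsets term
  multiplicityTutte-terms = ≡.refl

-- Matching the terms of the three polynomials

module DeletionContraction
  (K : HeytingField k k₁ k₂) (char0 : CharacteristicZero K)
  (Γ : AbelianGroup a ℓ) (σ : Splitting Γ)
  {n} (X : Vector (AbelianGroup.Carrier Γ) (suc n)) (i : Fin (suc n))
  (πl≢0 : ¬ (∀ j → Splitting.π σ (X i) j ≡ ℤ.0ℤ))
  (l∈⟨X₁⟩ : ⟨π_⟩ K σ (members Γ (removeAt X i) ⊤) (π⊗1 K σ (X i)))
  (σ₂ : Splitting (_/_ Γ (⟨ Γ ⟩₁ (X i))))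
  (D  : RankAndMultiplicity K σ X)
  (D₁ : RankAndMultiplicity K σ (removeAt X i))
  (D₂ : RankAndMultiplicity K σ₂ (map (quotientMap Γ (⟨ Γ ⟩₁ (X i))) (removeAt X i)))
  where

  private
    module Γ = AbelianGroup Γ
    module K = HeytingField K
    module D  = RankAndMultiplicity D
    module D₁ = RankAndMultiplicity D₁
    module D₂ = RankAndMultiplicity D₂
  open LinearAlgebra K using (_≃_; dimension-unique)
  open OverField.CharZero K char0 using (1#0)
  open Contraction K char0 Γ σ (X i) σ₂
  private
    X₁ = removeAt X i
    X₂ = map (quotientMap Γ (⟨ Γ ⟩₁ (X i))) X₁

  module _ (A : Subset n) where

    private
      S₁ = members Γ X₁ A
      S  = members Γ X (Vec.insertAt A i false)
      S⊆S₁ : S ⊆ S₁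
      S⊆S₁ = members-insertAt-false Γ X i A
      S₁⊆S : S₁ ⊆ S
      S₁⊆S = members-insertAt⁺ Γ X i A false

    r-deletion : D.r (Vec.insertAt A i false) ≡ D₁.r A
    r-deletion = dimension-unique 1#0 {V = ⟨π_⟩ K σ S} {V′ = ⟨π_⟩ K σ S₁}
      (⟨π⟩-mono K σ {S = S} {S₁} S⊆S₁) (⟨π⟩-mono K σ {S = S₁} {S} S₁⊆S)
      (D.r-dimension (Vec.insertAt A i false)) (D₁.r-dimension A)

    m-deletion : D.m (Vec.insertAt A i false) ≡ D₁.m A
    m-deletion = multiplicity-transfer D D₁ (Vec.insertAt A i false) A id id
      (⟨π⟩-mono K σ {S = S} {S₁} S⊆S₁) (⟨π⟩-mono K σ {S = S₁} {S} S₁⊆S)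
      forth back forth back
      where
      forth : Generated Γ S ⊆ Generated Γ S₁
      forth = generated-least Γ (⟨ Γ ⟩ S₁) (generator ∘ S⊆S₁)
      back : Generated Γ S₁ ⊆ Generated Γ S
      back = generated-least Γ (⟨ Γ ⟩ S) (generator ∘ S₁⊆S)

  r-⊤ : D.r ⊤ ≡ D₁.r ⊤
  r-⊤ = ≡.trans (≡.cong D.r (≡.sym (insertAt-⊤ i)))
    (dimension-unique 1#0 {V = ⟨π_⟩ K σ S} {V′ = ⟨π_⟩ K σ S₁}
      (span-least K λ (g , g∈S , u≃) → absorb g u≃ (members-insertAt-true Γ X i ⊤ g∈S))
      (⟨π⟩-mono K σ {S = S₁} {S} (members-insertAt⁺ Γ X i ⊤ true))
      (D.r-dimension (Vec.insertAt ⊤ i true)) (D₁.r-dimension ⊤))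
    where
    S₁ = members Γ X₁ ⊤
    S  = members Γ X (Vec.insertAt ⊤ i true)
    absorb : ∀ g {u} → u ≃ π⊗1 K σ g → g Γ.≈ X i ⊎ members Γ X₁ ⊤ g →
             ⟨π_⟩ K σ (members Γ X₁ ⊤) u
    absorb g u≃ (inj₁ g≈l) = respects
      (λ j → K.sym (K.trans (u≃ j) (K.reflexive (≡.cong (fromℤ K) (π-cong σ g≈l j))))) l∈⟨X₁⟩
    absorb g u≃ (inj₂ g∈X₁) = generator (g , g∈X₁ , u≃)

  module _ (A : Subset n) where

    private
      S₁ = members Γ X₁ A
      S  = members Γ X (Vec.insertAt A i true)
      S₂ = members Γ/l X₂ A

      S₁⊆S₂ : S₁ ⊆ S₂
      S₁⊆S₂ (j , j∈A , g≈) = j , j∈A , ≈⇒≈/l g≈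

      S₂⊆S₁ : ∀ {g} → S₂ g → ∃ λ h → S₁ h × AbelianGroup._≈_ Γ/l g h
      S₂⊆S₁ (j , j∈A , g∼) = X₁ j , (j , j∈A , Γ.refl) , g∼

      module C = Contracted {S₁ = S₁} {S} {S₂}
        (members-insertAt⁺ Γ X i A true) (lookup-member-insertAt Γ X i A)
        (members-insertAt-true Γ X i A) S₁⊆S₂ S₂⊆S₁

    r-contraction : D.r (Vec.insertAt A i true) ≡ suc (D₂.r A)
    r-contraction =
      C.dimension-contraction (D.r-dimension (Vec.insertAt A i true)) (D₂.r-dimension A) πl≢0

    -- The third isomorphism theorem: since ⟨λ⟩ lies in ⟨S⟩, which lies in the saturation of `S`,
    -- dividing both by ⟨λ⟩ keeps the index. On the common carrier the isomorphism is the identity.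
    m-contraction : D.m (Vec.insertAt A i true) ≡ D₂.m A
    m-contraction = multiplicity-transfer D D₂ (Vec.insertAt A i true) A id id
      C.saturation-push C.saturation-pull
      C.generated-push C.generated-pull C.generated-push C.generated-pull

  term-deletion : ∀ A → term D (Vec.insertAt A i false) ≡ term D₁ A
  term-deletion A = tutteTerm-cong (m-deletion A)
    (≡.cong₂ _∸_ r-⊤ (r-deletion A))
    (≡.cong₂ _∸_ (∣insertAt-false∣ A i) (r-deletion A))

  -- In both exponents minuend and subtrahend exceed their contracted counterparts by one, and
  -- `suc p ∸ suc q` computes to `p ∸ q`.
  term-contraction : ∀ A → term D (Vec.insertAt A i true) ≡ term D₂ A
  term-contraction A = tutteTerm-cong (m-contraction A)
    (≡.cong₂ _∸_ (≡.trans (≡.cong D.r (≡.sym (insertAt-⊤ i))) (r-contraction ⊤))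
                 (r-contraction A))
    (≡.cong₂ _∸_ (∣insertAt-true∣ A i) (r-contraction A))

theorem3p4 : {k k₁ k₂ a ℓ : Level} (K : HeytingField k k₁ k₂) → CharacteristicZero K →
    (Γ : AbelianGroup a ℓ) (σ : Splitting Γ) →
    {n : ℕ} (X : Vector (AbelianGroup.Carrier Γ) (suc n)) (i : Fin (suc n)) →
    let l   = X i
        Γ/l = _/_ Γ (⟨ Γ ⟩₁ l)
        X₁  = removeAt X i
        X₂  = map (quotientMap Γ (⟨ Γ ⟩₁ l)) X₁
        module Λ = AbelianGroup (ℤ^ Splitting.rank σ)
        open RawRing ℤ[x,y]
    in
    ¬ (Splitting.π σ l Λ.≈ Λ.ε) →
    ⟨π_⟩ K σ (members Γ X₁ ⊤) (π⊗1 K σ l) →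
    (σ₂ : Splitting Γ/l) →
    (D  : RankAndMultiplicity K σ X)
    (D₁ : RankAndMultiplicity K σ X₁)
    (D₂ : RankAndMultiplicity K σ₂ X₂) →
    multiplicityTutte D ≈ multiplicityTutte D₁ + multiplicityTutte D₂
theorem3p4 K char0 Γ σ X i πl≢0 l∈⟨X₁⟩ σ₂ D D₁ D₂ s t = begin
  coefficient₂ (multiplicityTutte D) s t
    ≡⟨ ≡.cong (λ f → coefficient₂ f s t) (multiplicityTutte-terms D) ⟩
  coefficient₂ (sumOverSubsets (term D)) s t
    ≡⟨ sumOverSubsets-insertAt i (term D) s t ⟩
  coefficient₂ (sumOverSubsets (λ A → term D (Vec.insertAt A i false)) ⊕
                sumOverSubsets (λ A → term D (Vec.insertAt A i true))) s t
    ≡⟨ ≡.cong₂ (λ f g → coefficient₂ (f ⊕ g) s t)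
         (sumOverSubsets-cong term-deletion) (sumOverSubsets-cong term-contraction) ⟩
  coefficient₂ (sumOverSubsets (term D₁) ⊕ sumOverSubsets (term D₂)) s t
    ≡⟨ ≡.cong₂ (λ f g → coefficient₂ (f ⊕ g) s t)
         (multiplicityTutte-terms D₁) (multiplicityTutte-terms D₂) ⟨
  coefficient₂ (multiplicityTutte D₁ ⊕ multiplicityTutte D₂) s t  ∎
  where
  open ≡.≡-Reasoning
  open DeletionContraction K char0 Γ σ X i πl≢0 l∈⟨X₁⟩ σ₂ D D₁ D₂
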